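{- Let $X$ be a simplicial surface. Then $X$ is a face-transitive surface satisfying $\mathrm{vf}(X)=(1,6)$ if and only if $H:=\lambda_X(\mathrm{Aut}(X))$ is a $(1,6)$-group of the face graph $\mathcal F(X)$ and the cycle double cover $\mathcal C^{(1,6)}(H)$ (for a suitable choice of the data defining it) contains exactly the vertex-defining cycles of $X$.
   Context: A simplicial complex $X$ on a finite non-empty set $P$ is a non-empty family of subsets of $P$ closed under taking subsets; $X_i$ is the set of its elements of cardinality $i+1$; elements of $X_0,X_1,X_2$ are vertices, edges, faces. A simplicial surface is a simplicial complex $X$ such that: all inclusion-maximal elements have cardinality $3$; every edge lies in exactly two faces; and for every vertex $v$ the faces containing $v$ can be arranged in a cyclic sequence $u(v)=(F_1,\dots,F_n)$ (each once), the umbrella of $v$, with $|F_i\cap F_{i+1}|=2$ (subscripts mod $n$). Simplicial surfaces are assumed strongly connected (any two faces joined by a sequence of faces with consecutive ones sharing an edge). $\mathrm{Aut}(X)$ is the automorphism group (permutations of $X_0$ mapping faces to faces). $X$ is face-transitive if $\mathrm{Aut}(X)$ is transitive on $X_2$; then $\mathrm{vf}(X)=(a,s)$ with $a$ the number of $\mathrm{Aut}(X)$-orbits on $X_0$ and $s$ the order of the stabiliser in $\mathrm{Aut}(X)$ of a face. All graphs are finite, simple, undirected, connected; their elements are called nodes and arcs. The face graph $\mathcal F(X)$ has node set $X_2$, two faces being joined by an arc iff they share an edge; it is cubic. $\lambda_X:\mathrm{Aut}(X)\to\mathrm{Aut}(\mathcal F(X))$ is the injective homomorphism sending an automorphism to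 the permutation it induces on $X_2$. Each umbrella $u(v)$ is a cycle in $\mathcal F(X)$, called a vertex-defining cycle of $X$. Cycles are considered up to rotation and reversal; for a subgroup $H$ of the automorphism group of a graph and a cycle $C$, $C^H$ denotes the $H$-orbit of $C$ under the induced action on cycles. A cycle double cover of a cubic graph is a set of cycles such that every arc lies in exactly two of them. It is vertex-faithful if all its cycles are chordless and any two distinct cycles share at most one arc. $\alpha$-cycles: let $\mathcal G=(V,E)$ be a cubic node-transitive graph (i.e. $\mathrm{Aut}(\mathcal G)$ is transitive on $V$), $F_1,\dots,F_n\in V$ with $\{F_i,F_{i+1}\}\in E$ for $1\le i\le n-1$, and $\sigma\in\mathrm{Aut}(\mathcal G)$ of order $\ell$ with $\sigma(F_1)=F_n$. Put $\Sigma=\{\sigma^i(F_j): 0\le i\le \ell-1,\ 1\le j\le n-1\}$. If $|\Sigma|=(n-1)\ell$, then $\alpha(\sigma,F_1,\dots,F_n)$ is the cycle $(\sigma(F_1),\dots,\sigma(F_{n-1}),\dots,\sigma^\ell(F_1),\dots,\sigma^\ell(F_{n-1}))$; otherwise it is the empty cycle. In particular $\alpha(\sigma,F_1,F_2)=(\sigma(F_1),\sigma^2(F_1),\dots,\sigma^\ell(F_1))$ when these nodes are distinct. A subgroup $H\le\mathrm{Aut}(\mathcal G)$ is a $(1,6)$-group of $\mathcal G$ if: (1) $H$ acts transitively on $V$ with $|H|=6|V|$; (2) there are $F_1,F_2\in V$ with $\{F_1,F_2\}\in E$ and $\sigma\in H$ with $\sigma(F_1)=F_2$ such that $\alpha(\sigma,F_1,F_2)^H$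 is a vertex-faithful cycle double cover of $\mathcal G$. This cover is denoted $\mathcal C^{(1,6)}(H)$. -}

module Defs where

open import Algebra.Bundles using (Group)
import Algebra.Definitions.RawMonoid as RawMonoid
open import Algebra.Morphism.Structures using (module GroupMorphisms)
open import Data.Bool.Base using (Bool; true; false; T; _∧_; if_then_else_)
open import Data.Bool.Properties using (T-irrelevant; T?; T-∧)
open import Data.Fin.Base using (Fin; zero; suc; toℕ)
open import Data.Fin.Properties using (+↔⊎; pigeonhole; suc-injective)
import Data.Fin.Properties as Fin
open import Data.Fin.Subset using (Subset; _∈_; _∉_; _⊆_; _∩_; _-_; ∣_∣; ⁅_⁆)
open import Data.Fin.Subset.Properties
  using (x∈⁅x⁆; x∈⁅y⁆⇒x≡y; ∣⁅x⁆∣≡1; ⊆-antisym; p─⊥≡p; _∈?_; _⊆?_; anySubset?;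
         p⊂q⇒∣p∣<∣q∣; p⊆q⇒∣p∣≤∣q∣; p─q⊆p; x∈p∧x≢y⇒x∈p-y)
open import Data.List.Base
  using (List; []; _∷_; _++_; _∷ʳ_; length; map; concatMap; reverse; upTo; deduplicate)
open import Data.List.Membership.Propositional using () renaming (_∈_ to _∈ₗ_)
open import Data.List.Relation.Unary.Linked using (Linked)
open import Data.List.Relation.Unary.Unique.Propositional using (Unique)
open import Data.Nat.Base using (ℕ; zero; suc; _+_; _*_; _<_; _≥_; NonZero; s≤s)
import Data.Nat.Properties as ℕ
open import Data.Product.Base using (Σ; ∃; ∃₂; _×_; _,_; proj₁; proj₂)
open import Data.Sum.Base using (_⊎_; inj₁; inj₂)
open import Data.Sum.Function.Propositional using (_⊎-↔_)
open import Data.Unit.Base using (⊤; tt)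
open import Data.Vec.Base using (Vec; []; _∷_; toList; init; here; there)
open import Function.Base using (_∘_; _on_; id)
open import Function.Bundles using (_↔_; _⇔_; Inverse; Equivalence; mk⇔; mk↔ₛ′)
open import Function.Construct.Composition using (_↔-∘_)
open import Function.Construct.Identity using (↔-id)
open import Function.Construct.Symmetry using (↔-sym)
open import Function.Definitions using (Bijective)
open import Level using (0ℓ)
open import Relation.Binary.Construct.Closure.ReflexiveTransitive using (Star; ε; _◅_)
open import Relation.Binary.Core using (Rel)
open import Relation.Binary.Definitions using (Decidable; DecidableEquality; Irreflexive; Symmetric)
open import Relation.Binary.PropositionalEquality
  using (_≡_; _≢_; refl; sym; trans; cong; cong₂; subst; _≗_)
open import Relation.Nullary using (¬_; Dec; yes; no; does; contradiction)
open import Relation.Nullary.Decidable using (_×-dec_; map′; ¬?; ⌊_⌋; toWitness; fromWitness)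
open import Relation.Unary using (Pred; U)

-- P has exactly n elements, elements related by _≈_ being identified.
HasCard : {A : Set} → Rel A 0ℓ → Pred A 0ℓ → ℕ → Set
HasCard _≈_ P n = ∃ λ (enum : Fin n → ∃ P) → Bijective _≡_ (_≈_ on proj₁) enum

record Subgroup (G : Group 0ℓ 0ℓ) : Set₁ where
  open Group G renaming (ε to ε′)
  field
    member    : Pred Carrier 0ℓ
    resp-≈    : ∀ {x y} → x ≈ y → member x → member y
    ∙-closed  : ∀ {x y} → member x → member y → member (x ∙ y)
    ε-closed  : member ε′
    ⁻¹-closed : ∀ {x} → member x → member (x ⁻¹)

module _ (G K : Group 0ℓ 0ℓ) where
  private
    module G = Group G
    module K = Group K
  open GroupMorphisms G.rawGroup K.rawGroup using (IsGroupHomomorphism)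

  imageSubgroup : {f : G.Carrier → K.Carrier} → IsGroupHomomorphism f → Subgroup K
  imageSubgroup {f} hom = record
    { member    = λ y → ∃ λ x → f x K.≈ y
    ; resp-≈    = λ { y≈z (x , fx≈y) → x , K.trans fx≈y y≈z }
    ; ∙-closed  = λ { (x , fx≈y) (x′ , fx′≈y′) →
                      x G.∙ x′ , K.trans (homo x x′) (K.∙-cong fx≈y fx′≈y′) }
    ; ε-closed  = G.ε , ε-homo
    ; ⁻¹-closed = λ { (x , fx≈y) → x G.⁻¹ , K.trans (⁻¹-homo x) (K.⁻¹-cong fx≈y) }
    }
    where open IsGroupHomomorphism hom

module _ (G : Group 0ℓ 0ℓ) where
  open Group G using (Carrier; _≈_; rawMonoid) renaming (ε to 1#)

  power : Carrier → ℕ → Carrier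
  power σ i = RawMonoid._×_ rawMonoid i σ

  HasOrder : Carrier → ℕ → Set
  HasOrder σ ℓ = 0 < ℓ × power σ ℓ ≈ 1# × (∀ k → 0 < k → k < ℓ → ¬ power σ k ≈ 1#)

-- Products are composed from right to left: (f ∙ g) x = f (g x).
permutationGroup : {A : Set} (P : Pred (A ↔ A) 0ℓ) →
                   P (↔-id A) →
                   (∀ {f g} → P f → P g → P (f ↔-∘ g)) →
                   (∀ {f} → P f → P (↔-sym f)) →
                   Group 0ℓ 0ℓ
permutationGroup {A} P id∈ ∘∈ sym∈ = record
  { Carrier = ∃ P
  ; _≈_     = λ f g → to f ≗ to g
  ; _∙_     = λ { (f , f∈) (g , g∈) → f ↔-∘ g , ∘∈ f∈ g∈ }
  ; ε       = ↔-id A , id∈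
  ; _⁻¹     = λ { (f , f∈) → ↔-sym f , sym∈ f∈ }
  ; isGroup = record
    { isMonoid = record
      { isSemigroup = record
        { isMagma = record
          { isEquivalence = record
            { refl  = λ _ → refl
            ; sym   = λ p x → sym (p x)
            ; trans = λ p q x → trans (p x) (q x)
            }
          ; ∙-cong = λ {f} {f′} {g} {g′} p q x → trans (cong (to f) (q x)) (p (to g′ x))
          }
        ; assoc = λ _ _ _ _ → refl
        }
      ; identity = (λ _ _ → refl) , (λ _ _ → refl)
      }
    ; inverse = (λ f x → Inverse.strictlyInverseʳ (proj₁ f) x)
              , (λ f x → Inverse.strictlyInverseˡ (proj₁ f) x)
    ; ⁻¹-cong = λ {f} {g} p x → inv-cong (proj₁ f) (proj₁ g) p x
    }
  }
  where
  to : ∃ P → A → A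
  to f = Inverse.to (proj₁ f)

  inv-cong : (f g : A ↔ A) → Inverse.to f ≗ Inverse.to g → Inverse.from f ≗ Inverse.from g
  inv-cong f g p x = trans
    (cong (Inverse.from f)
      (trans (sym (Inverse.strictlyInverseˡ g x)) (sym (p (Inverse.from g x)))))
    (Inverse.strictlyInverseʳ f (Inverse.from g x))

module _ {A : Set} where

  Cyclic : Rel A 0ℓ → List A → Set
  Cyclic R []       = ⊤
  Cyclic R (x ∷ xs) = Linked R (x ∷ xs ∷ʳ x)

  Rotation : Rel (List A) 0ℓ
  Rotation C D = ∃₂ λ as bs → C ≡ as ++ bs × D ≡ bs ++ as

  infix 4 _≈ᶜ_

  -- A cycle is given by the list of its nodes; this is equality of cycles.
  _≈ᶜ_ : Rel (List A) 0ℓ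
  C ≈ᶜ D = Rotation C D ⊎ Rotation (reverse C) D

record Graph : Set₁ where
  field
    Node       : Set
    size       : ℕ
    finite     : Fin size ↔ Node
    Adj        : Rel Node 0ℓ
    adj?       : Decidable Adj
    adj-irrefl : Irreflexive _≡_ Adj
    adj-sym    : Symmetric Adj
    connected  : ∀ u v → Star Adj u v

  _≟_ : DecidableEquality Node
  u ≟ v = map′ from-inj (cong (Inverse.from finite)) (Inverse.from finite u Fin.≟ Inverse.from finite v)
    where
    from-inj : ∀ {u v} → Inverse.from finite u ≡ Inverse.from finite v → u ≡ v
    from-inj {u} {v} eq = trans (sym (Inverse.strictlyInverseˡ finite u))
      (trans (cong (Inverse.to finite) eq) (Inverse.strictlyInverseˡ finite v))

  PreservesAdj : Pred (Node ↔ Node) 0ℓ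
  PreservesAdj π = ∀ u v → Adj u v ⇔ Adj (Inverse.to π u) (Inverse.to π v)

record CubicGraph : Set₁ where
  field
    graph : Graph
  open Graph graph public
  field
    cubic : ∀ u → HasCard _≡_ (Adj u) 3

graphAut : Graph → Group 0ℓ 0ℓ
graphAut G = permutationGroup PreservesAdj (λ _ _ → mk⇔ id id)
  (λ {f} {g} p q u v → mk⇔
    (Equivalence.to (p _ _) ∘ Equivalence.to (q u v))
    (Equivalence.from (q u v) ∘ Equivalence.from (p _ _)))
  (λ {f} p u v → mk⇔
    (Equivalence.from (p _ _) ∘ subst₂-sym f u v)
    (subst₂-id f u v ∘ Equivalence.to (p _ _)))
  where
  open Graph G
  subst₂-id : (f : Node ↔ Node) → ∀ u v →
    Adj (Inverse.to f (Inverse.from f u)) (Inverse.to f (Inverse.from f v)) → Adj u v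
  subst₂-id f u v = subst id (cong₂ Adj (Inverse.strictlyInverseˡ f u) (Inverse.strictlyInverseˡ f v))
  subst₂-sym : (f : Node ↔ Node) → ∀ u v →
    Adj u v → Adj (Inverse.to f (Inverse.from f u)) (Inverse.to f (Inverse.from f v))
  subst₂-sym f u v =
    subst id (sym (cong₂ Adj (Inverse.strictlyInverseˡ f u) (Inverse.strictlyInverseˡ f v)))

module Covers (G : CubicGraph) where
  open CubicGraph G

  Aut : Group 0ℓ 0ℓ
  Aut = graphAut graph

  infixr 8 _·_

  _·_ : Group.Carrier Aut → Node → Node
  σ · u = Inverse.to (proj₁ σ) u

  IsCycle : Pred (List Node) 0ℓ
  IsCycle C = length C ≥ 3 × Unique C × Cyclic Adj C

  CycleSet : Set₁
  CycleSet = Pred (List Node) 0ℓ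

  -- The arc {u , v} lies on C; the order of u and v is irrelevant because
  -- _≈ᶜ_ allows reversal.
  OnCycle : Node → Node → List Node → Set
  OnCycle u v C = ∃ λ ws → C ≈ᶜ u ∷ v ∷ ws

  Orbit : Subgroup Aut → List Node → CycleSet
  Orbit H C D = ∃ λ h → Subgroup.member H h × map (h ·_) C ≈ᶜ D

  Chordless : Pred (List Node) 0ℓ
  Chordless C = ∀ u v → u ∈ₗ C → v ∈ₗ C → Adj u v → OnCycle u v C

  IsCycleDoubleCover : CycleSet → Set
  IsCycleDoubleCover 𝒞 =
    (∀ C → 𝒞 C → IsCycle C) ×
    (∀ u v → Adj u v → HasCard _≈ᶜ_ (λ C → 𝒞 C × OnCycle u v C) 2)

  IsVertexFaithful : CycleSet → Set
  IsVertexFaithful 𝒞 =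
    (∀ C → 𝒞 C → Chordless C) ×
    (∀ C D → 𝒞 C → 𝒞 D → ¬ C ≈ᶜ D → ∀ u v u′ v′ →
       OnCycle u v C → OnCycle u v D → OnCycle u′ v′ C → OnCycle u′ v′ D →
       (u ≡ u′ × v ≡ v′) ⊎ (u ≡ v′ × v ≡ u′))

  -- α σ ℓ (F₁ ∷ … ∷ Fₙ ∷ []) is α(σ, F₁, …, Fₙ) for σ of order ℓ.  The
  -- conditions that F₁, …, Fₙ is a walk and that σ maps F₁ to Fₙ are
  -- imposed where α is used; the empty list is the empty cycle.
  module _ (σ : Group.Carrier Aut) (ℓ : ℕ) {m : ℕ} (F : Vec Node (suc m)) where

    block : ℕ → List Node
    block i = map (power Aut σ i ·_) (toList (init F))

    ∣Σ∣ : ℕ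
    ∣Σ∣ = length (deduplicate _≟_ (concatMap block (upTo ℓ)))

    α : List Node
    α = if does (∣Σ∣ ℕ.≟ m * ℓ) then concatMap (block ∘ suc) (upTo ℓ) else []

  record IsOneSixGroup (H : Subgroup Aut) : Set where
    open Subgroup H
    field
      transitive  : ∀ u v → ∃ λ σ → member σ × σ · u ≡ v
      cardinality : HasCard (Group._≈_ Aut) member (6 * size)
      F₁ F₂       : Node
      F₁~F₂       : Adj F₁ F₂
      σ           : Group.Carrier Aut
      σ∈H         : member σ
      σF₁≡F₂      : σ · F₁ ≡ F₂
      ℓ           : ℕ
      σ-order     : HasOrder Aut σ ℓ

    𝒞¹⁶ : CycleSet
    𝒞¹⁶ = Orbit H (α σ ℓ (F₁ ∷ F₂ ∷ []))

    field
      isCycleDoubleCover : IsCycleDoubleCover 𝒞¹⁶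
      isVertexFaithful   : IsVertexFaithful 𝒞¹⁶

-- A simplicial complex on the set P = Fin p.
record SimplicialComplex (p : ℕ) : Set where
  field
    P-nonempty : NonZero p
    contains   : Subset p → Bool
    nonempty   : ∃ λ s → T (contains s)
    closed     : ∀ s t → s ⊆ t → T (contains t) → T (contains s)

  -- Cell i is X_i; a vertex is thus a singleton {x}, and it is contained
  -- in a face F in the sense that {x} ⊆ F.
  Cell : ℕ → Set
  Cell i = Σ (Subset p) λ s → T (contains s) × ∣ s ∣ ≡ suc i

  Vertex Edge Face : Set
  Vertex = Cell 0
  Edge   = Cell 1
  Face   = Cell 2

  infix 4 _≼_

  _≼_ : ∀ {i j} → Cell i → Cell j → Set
  s ≼ t = proj₁ s ⊆ proj₁ t

  SharesEdge : Rel Face 0ℓ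
  SharesEdge F G = ∃ λ (e : Edge) → e ≼ F × e ≼ G

  -- G = π(F), subsets of P occurring in the complex being determined by
  -- their vertices.
  IsImage : Vertex ↔ Vertex → Face → Face → Set
  IsImage π F G = ∀ v → v ≼ F ⇔ Inverse.to π v ≼ G

  MapsFacesToFaces : Pred (Vertex ↔ Vertex) 0ℓ
  MapsFacesToFaces π = ∀ F → ∃ (IsImage π F)

  record Umbrella (v : Vertex) : Set where
    field
      faces    : List Face
      unique   : Unique faces
      complete : ∀ F → F ∈ₗ faces ⇔ v ≼ F
      cyclic   : Cyclic (λ F G → ∣ proj₁ F ∩ proj₁ G ∣ ≡ 2) faces

record SimplicialSurface (p : ℕ) : Set where
  field
    complex : SimplicialComplex p
  open SimplicialComplex complex public
  field
    pure : ∀ s → T (contains s) → (∀ t → T (contains t) → s ⊆ t → s ≡ t) → ∣ s ∣ ≡ 3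
    edge-in-two-faces : ∀ (e : Edge) → HasCard _≡_ (λ (F : Face) → e ≼ F) 2
    umbrella : ∀ v → Umbrella v
    strongly-connected : ∀ F G → Star SharesEdge F G

elem : ∀ {p} (s : Subset p) → Fin ∣ s ∣ → Fin p
elem (true  ∷ s) zero    = zero
elem (true  ∷ s) (suc i) = suc (elem s i)
elem (false ∷ s) i       = suc (elem s i)

elem-∈ : ∀ {p} (s : Subset p) i → elem s i ∈ s
elem-∈ (true  ∷ s) zero    = here
elem-∈ (true  ∷ s) (suc i) = there (elem-∈ s i)
elem-∈ (false ∷ s) i       = there (elem-∈ s i)

elem-injective : ∀ {p} (s : Subset p) {i j} → elem s i ≡ elem s j → i ≡ j
elem-injective (true  ∷ s) {zero}  {zero}  eq = refl
elem-injective (true  ∷ s) {suc i} {suc j} eq = cong suc (elem-injective s (suc-injective eq))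
elem-injective (false ∷ s) eq = elem-injective s (suc-injective eq)

elem-surjective : ∀ {p} (s : Subset p) {x} → x ∈ s → ∃ λ i → elem s i ≡ x
elem-surjective (true ∷ s) here = zero , refl
elem-surjective (true ∷ s) (there x∈s) with i , refl ← elem-surjective s x∈s = suc i , refl
elem-surjective (false ∷ s) (there x∈s) with i , refl ← elem-surjective s x∈s = i , refl

∣s-x∣ : ∀ {p} (s : Subset p) {x} → x ∈ s → suc ∣ s - x ∣ ≡ ∣ s ∣
∣s-x∣ (true  ∷ s) here = cong (suc ∘ ∣_∣) (p─⊥≡p s)
∣s-x∣ (true  ∷ s) (there x∈s) = cong suc (∣s-x∣ s x∈s)
∣s-x∣ (false ∷ s) (there x∈s) = ∣s-x∣ s x∈s

⊆∧∣∣≡⇒≡ : ∀ {p} {s t : Subset p} → s ⊆ t → ∣ s ∣ ≡ ∣ t ∣ → s ≡ t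
⊆∧∣∣≡⇒≡ {s = s} {t} s⊆t eq = ⊆-antisym s⊆t t⊆s
  where
  t⊆s : t ⊆ s
  t⊆s {x} x∈t with x ∈? s
  ... | yes x∈s = x∈s
  ... | no  x∉s = contradiction (p⊂q⇒∣p∣<∣q∣ ((λ {y} → s⊆t {y}) , x , x∈t , x∉s)) (ℕ.<-irrefl eq)

x∉s-x : ∀ {p} (s : Subset p) x → x ∉ s - x
x∉s-x (true  ∷ s) zero ()
x∉s-x (false ∷ s) zero ()
x∉s-x (true  ∷ s) (suc x) (there p) = x∉s-x s x p
x∉s-x (false ∷ s) (suc x) (there p) = x∉s-x s x p

∃-missing : ∀ {p} {s t : Subset p} → ∣ s ∣ < ∣ t ∣ → ∃ λ x → x ∈ t × x ∉ s
∃-missing {s = s} {t} s<t with Fin.any? (λ x → (x ∈? t) ×-dec ¬? (x ∈? s))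
... | yes found = found
... | no  none  = contradiction (p⊆q⇒∣p∣≤∣q∣ t⊆s) (ℕ.<⇒≱ s<t)
  where
  t⊆s : t ⊆ s
  t⊆s {x} x∈t with x ∈? s
  ... | yes x∈s = x∈s
  ... | no  x∉s = contradiction (x , x∈t , x∉s) none

count : ∀ {p} → (Subset p → Bool) → ℕ
count {zero}  Q = if Q [] then 1 else 0
count {suc p} Q = count (Q ∘ (true ∷_)) + count (Q ∘ (false ∷_))

count-↔ : ∀ {p} (Q : Subset p → Bool) → Fin (count Q) ↔ ∃ (T ∘ Q)
count-↔ {zero} Q with Q [] in eq
... | true  = mk↔ₛ′ (λ _ → [] , subst T (sym eq) tt) (λ _ → zero)
                    (λ { ([] , q) → cong ([] ,_) (T-irrelevant _ q) })
                    (λ { zero → refl })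
... | false = mk↔ₛ′ (λ ()) (λ { ([] , q) → contradiction (subst T eq q) id })
                    (λ { ([] , q) → contradiction (subst T eq q) id }) (λ ())
count-↔ {suc p} Q =
  mk↔ₛ′ (λ { (inj₁ (s , q)) → true ∷ s , q ; (inj₂ (s , q)) → false ∷ s , q })
        (λ { (true ∷ s , q) → inj₁ (s , q) ; (false ∷ s , q) → inj₂ (s , q) })
        (λ { (true ∷ s , q) → refl ; (false ∷ s , q) → refl })
        (λ { (inj₁ _) → refl ; (inj₂ _) → refl })
  ↔-∘ ((count-↔ (Q ∘ (true ∷_)) ⊎-↔ count-↔ (Q ∘ (false ∷_))) ↔-∘ +↔⊎)

module _ {A : Set} {n : ℕ} (finite : Fin n ↔ A) (f : A → A)
         (f-injective : ∀ {x y} → f x ≡ f y → x ≡ y) where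

  private
    iter : ℕ → A → A
    iter zero    x = x
    iter (suc k) x = f (iter k x)

    collide : ∀ {i j} x → i < j → iter i x ≡ iter j x → ∃ λ y → f y ≡ x
    collide {zero}  {suc j} x _         eq = iter j x , sym eq
    collide {suc i} {suc j} x (s≤s i<j) eq = collide x i<j (f-injective eq)

  injective⇒surjective : ∀ x → ∃ λ y → f y ≡ x
  injective⇒surjective x
    with i , j , i<j , eq ← pigeonhole {n} {suc n} (ℕ.n<1+n n) (λ k → Inverse.from finite (iter (toℕ k) x))
    = collide x i<j (trans (sym (Inverse.strictlyInverseˡ finite _))
        (trans (cong (Inverse.to finite) eq) (Inverse.strictlyInverseˡ finite _)))

module ComplexProperties {p} (K : SimplicialComplex p) where
  open SimplicialComplex K

  cell-≡ : ∀ {i} {s t : Cell i} → proj₁ s ≡ proj₁ t → s ≡ t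
  cell-≡ {s = s , a , b} {.s , a′ , b′} refl =
    cong (s ,_) (cong₂ _,_ (T-irrelevant a a′) (ℕ.≡-irrelevant b b′))

  cell-⊆⇒≡ : ∀ {i} {s t : Cell i} → s ≼ t → s ≡ t
  cell-⊆⇒≡ {s = s} {t} s≼t =
    cell-≡ (⊆∧∣∣≡⇒≡ s≼t (trans (proj₂ (proj₂ s)) (sym (proj₂ (proj₂ t)))))

  private
    isCell : ℕ → Subset p → Bool
    isCell i s = contains s ∧ ⌊ ∣ s ∣ ℕ.≟ suc i ⌋

  #cells : ℕ → ℕ
  #cells i = count (isCell i)

  cells-finite : ∀ i → Fin (#cells i) ↔ Cell i
  cells-finite i =
    mk↔ₛ′ (λ { (s , q) → let a , b = Equivalence.to T-∧ q in s , a , toWitness b })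
          (λ { (s , a , b) → s , Equivalence.from T-∧ (a , fromWitness b) })
          (λ { (s , a , b) → cell-≡ refl })
          (λ { (s , q) → cong (s ,_) (T-irrelevant _ q) })
    ↔-∘ count-↔ (isCell i)

  anyCell? : ∀ {i} {Q : Subset p → Set} → (∀ s → Dec (Q s)) → Dec (∃ λ (s : Cell i) → Q (proj₁ s))
  anyCell? {i} Q? = map′
    (λ { (s , a , b , q) → (s , a , b) , q })
    (λ { ((s , a , b) , q) → s , a , b , q })
    (anySubset? (λ s → T? (contains s) ×-dec (∣ s ∣ ℕ.≟ suc i) ×-dec Q? s))

  vertex : ∀ {i} {x} (s : Cell i) → x ∈ proj₁ s → Vertex
  vertex {x = x} s x∈s = ⁅ x ⁆ , closed _ _ (⁅⁆⊆ x∈s) (proj₁ (proj₂ s)) , ∣⁅x⁆∣≡1 x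
    where
    ⁅⁆⊆ : ∀ {x} {s : Subset p} → x ∈ s → ⁅ x ⁆ ⊆ s
    ⁅⁆⊆ {x} x∈s y∈ with refl ← x∈⁅y⁆⇒x≡y x y∈ = x∈s

  point : Vertex → Fin p
  point (s , _ , eq) = elem s (subst Fin (sym eq) zero)

  point-∈ : ∀ v → point v ∈ proj₁ v
  point-∈ (s , _ , eq) = elem-∈ s _

  vertex-≡ : ∀ v → proj₁ v ≡ ⁅ point v ⁆
  vertex-≡ v = sym (cong proj₁ (cell-⊆⇒≡ {s = vertex v (point-∈ v)} {v} sub))
    where
    sub : ⁅ point v ⁆ ⊆ proj₁ v
    sub y∈ with refl ← x∈⁅y⁆⇒x≡y (point v) y∈ = point-∈ v

  ≼⁻ : ∀ {i} (v : Vertex) (s : Cell i) → v ≼ s → point v ∈ proj₁ s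
  ≼⁻ v s v≼s = v≼s (point-∈ v)

  ≼⁺ : ∀ {i} (v : Vertex) (s : Cell i) → point v ∈ proj₁ s → v ≼ s
  ≼⁺ v s ∈s {y} y∈ with refl ← x∈⁅y⁆⇒x≡y (point v) (subst (y ∈_) (vertex-≡ v) y∈) = ∈s

  vertex≼ : ∀ {i j} {x} (s : Cell i) (x∈s : x ∈ proj₁ s) (t : Cell j) →
            x ∈ proj₁ t → vertex s x∈s ≼ t
  vertex≼ {x = x} s x∈s t x∈t y∈ with refl ← x∈⁅y⁆⇒x≡y x y∈ = x∈t

  vertex≼⁻ : ∀ {i j} {x} (s : Cell i) (x∈s : x ∈ proj₁ s) (t : Cell j) →
             vertex s x∈s ≼ t → x ∈ proj₁ t
  vertex≼⁻ {x = x} s x∈s t v≼t = v≼t (x∈⁅x⁆ x)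

  faces-≡ : (F G : Face) → (∀ (v : Vertex) → v ≼ F ⇔ v ≼ G) → F ≡ G
  faces-≡ F G same = cell-⊆⇒≡ {s = F} {G} F⊆G
    where
    F⊆G : F ≼ G
    F⊆G {x} x∈F = vertex≼⁻ F x∈F G
      (Equivalence.to (same (vertex F x∈F)) (vertex≼ F x∈F F x∈F))

  ⇔-sym′ : ∀ {A B : Set} → A ⇔ B → B ⇔ A
  ⇔-sym′ e = mk⇔ (Equivalence.from e) (Equivalence.to e)

  ⇔-trans′ : ∀ {A B C : Set} → A ⇔ B → B ⇔ C → A ⇔ C
  ⇔-trans′ e f = mk⇔ (Equivalence.to f ∘ Equivalence.to e) (Equivalence.from e ∘ Equivalence.from f)

  image-sym : ∀ {π F G} → IsImage π F G → IsImage (↔-sym π) G F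
  image-sym {π} {F} {G} im v = ⇔-sym′ (subst (λ w → Inverse.from π v ≼ F ⇔ w ≼ G)
    (Inverse.strictlyInverseˡ π v) (im (Inverse.from π v)))

  image-trans : ∀ {π ρ F G L} → IsImage ρ F G → IsImage π G L → IsImage (π ↔-∘ ρ) F L
  image-trans {ρ = ρ} im im′ v = ⇔-trans′ (im v) (im′ (Inverse.to ρ v))

  image-unique : ∀ {π ρ F G L} → Inverse.to π ≗ Inverse.to ρ →
                 IsImage π F G → IsImage ρ F L → G ≡ L
  image-unique {π} {ρ} {F} {G} {L} eq im im′ = faces-≡ G L λ v →
    subst (λ w → w ≼ G ⇔ w ≼ L) (Inverse.strictlyInverseˡ π v)
      (⇔-trans′ (⇔-sym′ (im (Inverse.from π v)))
        (subst (λ w → Inverse.from π v ≼ F ⇔ w ≼ L) (sym (eq _)) (im′ (Inverse.from π v))))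

  image-id : ∀ F → IsImage (↔-id Vertex) F F
  image-id F v = mk⇔ (λ q → q) (λ q → q)

  mapsFaces-id : MapsFacesToFaces (↔-id Vertex)
  mapsFaces-id F = F , image-id F

  mapsFaces-∘ : ∀ {π ρ} → MapsFacesToFaces π → MapsFacesToFaces ρ → MapsFacesToFaces (π ↔-∘ ρ)
  mapsFaces-∘ {π} {ρ} maps maps′ F = proj₁ (maps (proj₁ (maps′ F))) ,
    image-trans {π} {ρ} {F} {proj₁ (maps′ F)} {proj₁ (maps (proj₁ (maps′ F)))}
      (proj₂ (maps′ F)) (proj₂ (maps (proj₁ (maps′ F))))

  -- Abstract because unfolding the pigeonhole argument is very slow.
  abstract
    mapsFaces-sym : ∀ {π} → MapsFacesToFaces π → MapsFacesToFaces (↔-sym π)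
    mapsFaces-sym {π} maps G = proj₁ preimage , subst (λ L → IsImage (↔-sym π) L (proj₁ preimage))
      (proj₂ preimage) (image-sym {π} {proj₁ preimage} {proj₁ (maps (proj₁ preimage))} (proj₂ (maps (proj₁ preimage))))
      where
      inj : ∀ {F F′} → proj₁ (maps F) ≡ proj₁ (maps F′) → F ≡ F′
      inj {F} {F′} eq = image-unique {↔-sym π} {↔-sym π} {proj₁ (maps F)} {F} {F′} (λ _ → refl)
        (image-sym {π} {F} {proj₁ (maps F)} (proj₂ (maps F)))
        (subst (λ L → IsImage (↔-sym π) L F′) (sym eq)
          (image-sym {π} {F′} {proj₁ (maps F′)} (proj₂ (maps F′))))
      preimage : ∃ λ F → proj₁ (maps F) ≡ G
      preimage = injective⇒surjective (cells-finite 2) (proj₁ ∘ maps) inj G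

  image-sharesEdge : ∀ {π F F′ G G′} → IsImage π F G → IsImage π F′ G′ →
                     SharesEdge F F′ → SharesEdge G G′
  image-sharesEdge {π} {F} {F′} {G} {G′} im im′ (e , e⊆F , e⊆F′)
    with x , x∈F , x∉e ← ∃-missing {s = proj₁ e} {proj₁ F}
           (subst (_< ∣ proj₁ F ∣) (sym (proj₂ (proj₂ e))) (ℕ.≤-reflexive (sym (proj₂ (proj₂ F)))))
    = (d , closed _ _ d⊆G (proj₁ (proj₂ G)) , ∣d∣≡2) , d⊆G , d⊆G′
    where
    v : Vertex
    v = vertex F x∈F
    x′ : Fin p
    x′ = point (Inverse.to π v)
    x′∈G : x′ ∈ proj₁ G
    x′∈G = ≼⁻ (Inverse.to π v) G (Equivalence.to (im v) (vertex≼ F x∈F F x∈F))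
    d : Subset p
    d = proj₁ G - x′
    d⊆G : d ⊆ proj₁ G
    d⊆G = p─q⊆p (proj₁ G) ⁅ x′ ⁆
    ∣d∣≡2 : ∣ d ∣ ≡ 2
    ∣d∣≡2 = ℕ.suc-injective (trans (∣s-x∣ (proj₁ G) x′∈G) (proj₂ (proj₂ G)))
    e≡F-x : proj₁ e ≡ proj₁ F - x
    e≡F-x = ⊆∧∣∣≡⇒≡ (λ {z} z∈e → x∈p∧x≢y⇒x∈p-y (e⊆F z∈e) λ { refl → x∉e z∈e })
      (trans (proj₂ (proj₂ e)) (sym (ℕ.suc-injective (trans (∣s-x∣ (proj₁ F) x∈F) (proj₂ (proj₂ F))))))
    d⊆G′ : d ⊆ proj₁ G′
    d⊆G′ {y′} y′∈d = vertex≼⁻ G y′∈G G′ (subst (_≼ G′) πw≡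
        (Equivalence.to (im′ w) (≼⁺ w F′ (e⊆F′ w∈e))))
      where
      y′∈G : y′ ∈ proj₁ G
      y′∈G = d⊆G y′∈d
      w : Vertex
      w = Inverse.from π (vertex G y′∈G)
      πw≡ : Inverse.to π w ≡ vertex G y′∈G
      πw≡ = Inverse.strictlyInverseˡ π _
      w∈F : point w ∈ proj₁ F
      w∈F = ≼⁻ w F (Equivalence.from (im w) (subst (_≼ G) (sym πw≡) (vertex≼ G y′∈G G y′∈G)))
      w≢x : point w ≢ x
      w≢x w≡x = x∉s-x (proj₁ G) x′ (subst (_∈ d) y′≡x′ y′∈d)
        where
        w≡v : w ≡ v
        w≡v = cell-≡ (trans (vertex-≡ w) (cong ⁅_⁆ w≡x))
        y′≡x′ : y′ ≡ x′
        y′≡x′ = sym (x∈⁅y⁆⇒x≡y y′ (subst (x′ ∈_)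
          (cong proj₁ (trans (cong (Inverse.to π) (sym w≡v)) πw≡)) (point-∈ (Inverse.to π v))))
      w∈e : point w ∈ proj₁ e
      w∈e = subst (point w ∈_) (sym e≡F-x) (x∈p∧x≢y⇒x∈p-y w∈F w≢x)

module SurfaceProperties {p} (X : SimplicialSurface p) where
  open SimplicialSurface X
  open ComplexProperties complex public

  Adjacent : Rel Face 0ℓ
  Adjacent F G = F ≢ G × SharesEdge F G

  _≟ᶠ_ : DecidableEquality Face
  F ≟ᶠ G = map′ (cell-⊆⇒≡ {s = F} {G}) (λ { refl q → q }) (proj₁ F ⊆? proj₁ G)

  adjacent? : Decidable Adjacent
  adjacent? F G = ¬? (F ≟ᶠ G) ×-dec anyCell? (λ s → (s ⊆? proj₁ F) ×-dec (s ⊆? proj₁ G))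

  face-graph-connected : ∀ F G → Star Adjacent F G
  face-graph-connected F G = convert (strongly-connected F G)
    where
    convert : ∀ {F G} → Star SharesEdge F G → Star Adjacent F G
    convert ε = ε
    convert {F} (_◅_ {j = F′} shares path) with F ≟ᶠ F′
    ... | yes refl = convert path
    ... | no  F≢F′ = (F≢F′ , shares) ◅ convert path

  otherFace : ∀ (e : Edge) (F : Face) → e ≼ F →
              ∃ λ G → F ≢ G × e ≼ G × (∀ L → F ≢ L → e ≼ L → L ≡ G)
  otherFace e F e≼F with enum , inj , surj ← edge-in-two-faces e = result
    where
    face : Fin 2 → Face
    face = proj₁ ∘ enum
    hit : ∀ L → e ≼ L → ∃ λ i → face i ≡ L
    hit L e≼L with i , eq ← surj (L , λ {x} → e≼L {x}) = i , eq refl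
    pick : ∀ i j → i ≢ j → (∀ k → k ≢ i → k ≡ j) → face i ≡ F →
           ∃ λ G → F ≢ G × e ≼ G × (∀ L → F ≢ L → e ≼ L → L ≡ G)
    pick i j i≢j only refl = face j , (λ eq → i≢j (inj eq)) , (λ {x} → proj₂ (enum j) {x}) , rest
      where
      rest : ∀ L → face i ≢ L → e ≼ L → L ≡ face j
      rest L F≢L e≼L with k , refl ← hit L e≼L = cong face (only k λ { refl → F≢L refl })
    result : ∃ λ G → F ≢ G × e ≼ G × (∀ L → F ≢ L → e ≼ L → L ≡ G)
    result with hit F e≼F
    ... | zero , eq = pick zero (suc zero) (λ ())
                        (λ { zero k≢ → contradiction refl k≢ ; (suc zero) _ → refl }) eq
    ... | suc zero , eq = pick (suc zero) zero (λ ())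
                        (λ { zero _ → refl ; (suc zero) k≢ → contradiction refl k≢ }) eq

  face-graph-cubic : ∀ F → HasCard _≡_ (Adjacent F) 3
  face-graph-cubic F = nbr , nbr-injective , nbr-surjective
    where
    corner : Fin 3 → Fin p
    corner i = elem (proj₁ F) (subst Fin (sym (proj₂ (proj₂ F))) i)
    corner-∈ : ∀ i → corner i ∈ proj₁ F
    corner-∈ i = elem-∈ (proj₁ F) _
    opposite : ∀ {x} → x ∈ proj₁ F → Edge
    opposite {x} x∈F = proj₁ F - x
      , closed _ _ (p─q⊆p (proj₁ F) ⁅ x ⁆) (proj₁ (proj₂ F))
      , ℕ.suc-injective (trans (∣s-x∣ (proj₁ F) x∈F) (proj₂ (proj₂ F)))
    opposite≼ : ∀ {x} (x∈F : x ∈ proj₁ F) → opposite x∈F ≼ F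
    opposite≼ {x} x∈F = p─q⊆p (proj₁ F) ⁅ x ⁆
    side : ∀ i → ∃ λ G → F ≢ G × opposite (corner-∈ i) ≼ G ×
                   (∀ L → F ≢ L → opposite (corner-∈ i) ≼ L → L ≡ G)
    side i = otherFace (opposite (corner-∈ i)) F (opposite≼ (corner-∈ i))
    nbr : Fin 3 → ∃ (Adjacent F)
    nbr i with G , F≢G , e≼G , _ ← side i =
      G , F≢G , opposite (corner-∈ i) , opposite≼ (corner-∈ i) , (λ {x} → e≼G {x})
    corner-injective : ∀ {i j} → corner i ≡ corner j → i ≡ j
    corner-injective {i} {j} eq = subst-inj (proj₂ (proj₂ F)) (elem-injective (proj₁ F) eq)
      where
      subst-inj : ∀ {n} (eq : n ≡ 3) {i j} → subst Fin (sym eq) i ≡ subst Fin (sym eq) j → i ≡ j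
      subst-inj refl q = q
    corner-surjective : ∀ {x} → x ∈ proj₁ F → ∃ λ i → corner i ≡ x
    corner-surjective x∈F with k , refl ← elem-surjective (proj₁ F) x∈F
      = back (proj₂ (proj₂ F)) k
      where
      back : ∀ {n} (eq : n ≡ 3) {f : Fin n → Fin p} k → ∃ λ i → f (subst Fin (sym eq) i) ≡ f k
      back refl k = k , refl
    nbr-injective : ∀ {i j} → proj₁ (nbr i) ≡ proj₁ (nbr j) → i ≡ j
    nbr-injective {i} {j} eq with i Fin.≟ j
    ... | yes i≡j = i≡j
    ... | no  i≢j = contradiction (cell-⊆⇒≡ {s = F} {proj₁ (side i)} F⊆) (proj₁ (proj₂ (side i)))
      where
      F⊆ : F ≼ proj₁ (side i)
      F⊆ {x} x∈F with x Fin.≟ corner i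
      ... | no  x≢ = proj₁ (proj₂ (proj₂ (side i))) (x∈p∧x≢y⇒x∈p-y x∈F x≢)
      ... | yes refl = subst (λ G → corner i ∈ proj₁ G) (sym eq)
            (proj₁ (proj₂ (proj₂ (side j)))
              (x∈p∧x≢y⇒x∈p-y (corner-∈ i) (i≢j ∘ corner-injective)))
    nbr-surjective : ∀ G → ∃ λ i → ∀ {j} → j ≡ i → proj₁ (nbr j) ≡ proj₁ G
    nbr-surjective (G , F≢G , e , e≼F , e≼G)
      with x , x∈F , x∉e ← ∃-missing {s = proj₁ e} {proj₁ F}
             (subst (_< ∣ proj₁ F ∣) (sym (proj₂ (proj₂ e))) (ℕ.≤-reflexive (sym (proj₂ (proj₂ F)))))
      with i , refl ← corner-surjective x∈F
      = i , λ { refl → sym (proj₂ (proj₂ (proj₂ (side i))) G F≢G (subst (_⊆ proj₁ G) e≡ e≼G)) }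
      where
      e≡ : proj₁ e ≡ proj₁ F - corner i
      e≡ = cong proj₁ (cell-⊆⇒≡ {s = e} {opposite (corner-∈ i)}
             (λ {z} z∈e → x∈p∧x≢y⇒x∈p-y (e≼F z∈e) λ { refl → x∉e z∈e }))

module Surfaces {p} (X : SimplicialSurface p) where
  open SimplicialSurface X
  open SurfaceProperties X

  Aut : Group 0ℓ 0ℓ
  Aut = permutationGroup MapsFacesToFaces mapsFaces-id
    (λ {π} {ρ} → mapsFaces-∘ {π} {ρ}) (λ {π} → mapsFaces-sym {π})

  faceGraph : CubicGraph
  faceGraph = record
    { graph = record
      { Node       = Face
      ; size       = #cells 2
      ; finite     = cells-finite 2
      ; Adj        = Adjacent
      ; adj?       = adjacent?
      ; adj-irrefl = λ { refl (F≢F , _) → F≢F refl }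
      ; adj-sym    = λ { (F≢G , e , e≼F , e≼G) → F≢G ∘ sym , e , (λ {x} → e≼G {x}) , (λ {x} → e≼F {x}) }
      ; connected  = face-graph-connected
      }
    ; cubic = face-graph-cubic
    }

  open Covers faceGraph public using (CycleSet; IsOneSixGroup) renaming (Aut to AutF)

  infixr 8 _·ᵛ_ _·ᶠ_

  _·ᵛ_ : Group.Carrier Aut → Vertex → Vertex
  φ ·ᵛ v = Inverse.to (proj₁ φ) v

  _·ᶠ_ : Group.Carrier Aut → Face → Face
  φ ·ᶠ F = proj₁ (proj₂ φ F)

  ·ᶠ-image : ∀ φ F → IsImage (proj₁ φ) F (φ ·ᶠ F)
  ·ᶠ-image φ F = proj₂ (proj₂ φ F)

  ·ᶠ-cong : ∀ φ ψ → Group._≈_ Aut φ ψ → ∀ F → φ ·ᶠ F ≡ ψ ·ᶠ F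
  ·ᶠ-cong φ ψ eq F = image-unique {proj₁ φ} {proj₁ ψ} {F} eq (·ᶠ-image φ F) (·ᶠ-image ψ F)

  ·ᶠ-inverseˡ : ∀ φ F → Group._⁻¹ Aut φ ·ᶠ φ ·ᶠ F ≡ F
  ·ᶠ-inverseˡ φ F = ·ᶠ-cong (φ⁻¹ ∙ φ) (Group.ε Aut) (Group.inverseˡ Aut φ) F
    where open Group Aut using (_∙_); φ⁻¹ = Group._⁻¹ Aut φ

  ·ᶠ-inverseʳ : ∀ φ F → φ ·ᶠ Group._⁻¹ Aut φ ·ᶠ F ≡ F
  ·ᶠ-inverseʳ φ F = ·ᶠ-cong (φ ∙ φ⁻¹) (Group.ε Aut) (Group.inverseʳ Aut φ) F
    where open Group Aut using (_∙_); φ⁻¹ = Group._⁻¹ Aut φ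

  λX : Group.Carrier Aut → Group.Carrier AutF
  λX φ = mk↔ₛ′ (φ ·ᶠ_) (Group._⁻¹ Aut φ ·ᶠ_) (·ᶠ-inverseʳ φ) (·ᶠ-inverseˡ φ)
       , λ F G → mk⇔ (preserves φ F G) (reflects F G)
    where
    preserves : ∀ ψ F G → Adjacent F G → Adjacent (ψ ·ᶠ F) (ψ ·ᶠ G)
    preserves ψ F G (F≢G , shares) =
        (λ eq → F≢G (trans (sym (·ᶠ-inverseˡ ψ F))
                      (trans (cong (Group._⁻¹ Aut ψ ·ᶠ_) eq) (·ᶠ-inverseˡ ψ G))))
      , image-sharesEdge {proj₁ ψ} {F} {G} {ψ ·ᶠ F} {ψ ·ᶠ G} (·ᶠ-image ψ F) (·ᶠ-image ψ G) shares
    reflects : ∀ F G → Adjacent (φ ·ᶠ F) (φ ·ᶠ G) → Adjacent F G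
    reflects F G adj = subst id (cong₂ Adjacent (·ᶠ-inverseˡ φ F) (·ᶠ-inverseˡ φ G))
      (preserves (Group._⁻¹ Aut φ) _ _ adj)

  open GroupMorphisms (Group.rawGroup Aut) (Group.rawGroup AutF) using (IsGroupHomomorphism)

  λX-homomorphism : IsGroupHomomorphism λX
  λX-homomorphism = record
    { isMonoidHomomorphism = record
      { isMagmaHomomorphism = record
        { isRelHomomorphism = record { cong = λ {φ} {ψ} → ·ᶠ-cong φ ψ }
        ; homo = λ _ _ _ → refl
        }
      ; ε-homo = λ _ → refl
      }
    ; ⁻¹-homo = λ _ _ → refl
    }

  H : Subgroup AutF
  H = imageSubgroup Aut AutF λX-homomorphism

  FaceTransitive : Set
  FaceTransitive = ∀ F G → ∃ λ φ → φ ·ᶠ F ≡ G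

  SameOrbit : Rel Vertex 0ℓ
  SameOrbit v w = ∃ λ φ → φ ·ᵛ v ≡ w

  -- vf(X) = (a , s), for face-transitive X; the order of the stabiliser
  -- is then independent of the face.
  HasVF : ℕ × ℕ → Set
  HasVF (a , s) = HasCard SameOrbit U a ×
                  (∀ F → HasCard (Group._≈_ Aut) (λ φ → φ ·ᶠ F ≡ F) s)

  VertexDefining : CycleSet
  VertexDefining C = ∃ λ v → Umbrella.faces (umbrella v) ≈ᶜ C

-- In a surface an automorphism is determined by its effect on one flag (a face with two of its
-- vertices in order): the face across an edge is unique, so agreement spreads from face to face
-- along the connected face graph.  Each face carries six flags, so there are 6|X₂| flags in all.
-- Hence vf(X) = (1,6) together with face-transitivity, and |H| = 6|X₂| together with
-- face-transitivity, both say by counting that Aut(X) is transitive on flags.  Then an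
-- automorphism that turns the umbrella of a vertex by one step exists, and the α-cycle it
-- defines is that umbrella; its H-orbit consists of all umbrellas since Aut(X) is transitive on
-- vertices.  Umbrellas are always a vertex-faithful cycle double cover: an arc {F , G} lies on
-- exactly the umbrellas of the two vertices in F ∩ G.  Conversely, a cover that is a single
-- H-orbit forces all umbrellas, hence all vertices, into one orbit.

module Submission where

open import Defs
open import Algebra.Bundles using (Group)
open import Data.Bool.Base using (T; if_then_else_)
open import Data.Bool.Properties using (T?)
open import Data.Fin.Base using (Fin; zero; suc; punchIn; punchOut; combine; remQuot)
open import Data.Fin.Patterns using (0F; 1F; 2F)
import Data.Fin.Properties as Fin
open import Data.Fin.Subset using (Subset; _∈_; _⊆_; _∩_; _-_; ∣_∣; ⁅_⁆)
open import Data.Fin.Subset.Properties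
  using (_⊆?_; anySubset?; ∣p∣≤n; p⊆q⇒∣p∣≤∣q∣; ∩-idem; x∈p∩q⁻; p─q⊆p;
         x∈⁅y⁆⇒x≡y; x∈p∧x≢y⇒x∈p-y)
open import Data.List.Base
  using (List; []; _∷_; _++_; _∷ʳ_; [_]; length; initLast; _∷ʳ′_; map; concatMap; reverse;
         upTo; applyUpTo; deduplicate)
open import Data.List.Membership.Propositional using () renaming (_∈_ to _∈ₗ_)
open import Data.List.Membership.Propositional.Properties
  using (∈-∃++; ∈-map⁺; ∈-map⁻; ∈-++⁻; ∈-++⁺ʳ; ∈-applyUpTo⁺)
open import Data.List.Membership.Propositional.Properties.WithK using (unique∧set⇒bag)
open import Data.List.Properties
  using (map-++; map-id; map-cong; map-applyUpTo; length-applyUpTo; reverse-++; unfold-reverse;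
         ++-assoc; ++-identityʳ; filter-all; ∷-injective)
open import Data.List.Relation.Binary.BagAndSetEquality using (∼bag⇒↭)
open import Data.List.Relation.Binary.Permutation.Propositional using (_↭_; ↭-sym; ↭-trans; ↭⇒↭ₛ)
open import Data.List.Relation.Binary.Permutation.Propositional.Properties
  using (∈-resp-↭; ↭-length; ++-comm; ↭-reverse)
import Data.List.Relation.Binary.Permutation.Setoid.Properties as SetoidPerm
import Data.List.Relation.Unary.All as All
open import Data.List.Relation.Unary.All using (_∷_)
import Data.List.Relation.Unary.AllPairs as AllPairs
open import Data.List.Relation.Unary.AllPairs using ([]; _∷_)
open import Data.List.Relation.Unary.Any using (here; there)
open import Data.List.Relation.Unary.Linked using (Linked; []; [-]; _∷_)
import Data.List.Relation.Unary.Linked as Linked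
import Data.List.Relation.Unary.Linked.Properties as Linked
open import Data.List.Relation.Unary.Unique.Propositional using (Unique)
import Data.List.Relation.Unary.Unique.Propositional.Properties as Unique
open import Data.Nat.Base using (ℕ; zero; suc; _+_; _*_; _≤_; _<_; s≤s; z≤n)
import Data.Nat.Properties as ℕ
open import Data.Product.Base using (_×_; _,_; ∃; ∃₂; proj₁; proj₂)
open import Data.Sum.Base using (_⊎_; inj₁; inj₂; [_,_]′)
open import Data.Vec.Base using ([]; _∷_)
open import Function.Base using (_∘_)
open import Function.Bundles using (_⇔_; _↔_; Equivalence; Inverse; mk⇔)
open import Function.Construct.Identity using (↔-id)
open import Level using (0ℓ)
open import Relation.Binary.Construct.Closure.ReflexiveTransitive using (Star; ε; _◅_)
open import Relation.Binary.Core using (Rel)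
open import Relation.Binary.Definitions using (DecidableEquality; Symmetric)
open import Relation.Binary.PropositionalEquality
  using (_≡_; _≢_; refl; sym; trans; cong; cong₂; subst; subst₂; ≢-sym; setoid)
open import Relation.Nullary using (¬_; Dec; yes; no; contradiction)
open import Relation.Nullary.Decidable using (_×-dec_; ¬?; map′; dec-true)
open import Relation.Unary using (_≐_)

-- Walks and cycles as lists, up to rotation and reversal.

module _ {A : Set} where

  Linked-∷ʳ⁺ : ∀ {R : Rel A 0ℓ} xs {x y} → Linked R (xs ∷ʳ x) → R x y → Linked R (xs ∷ʳ x ∷ʳ y)
  Linked-∷ʳ⁺ []           [-]          r = r ∷ [-]
  Linked-∷ʳ⁺ (_ ∷ [])     (q ∷ l)      r = q ∷ Linked-∷ʳ⁺ [] l r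
  Linked-∷ʳ⁺ (_ ∷ y ∷ xs) (q ∷ l)      r = q ∷ Linked-∷ʳ⁺ (y ∷ xs) l r

  Linked-∷ʳ⁻ : ∀ {R : Rel A 0ℓ} xs {x y} → Linked R (xs ∷ʳ x ∷ʳ y) → R x y
  Linked-∷ʳ⁻ []           (r ∷ _) = r
  Linked-∷ʳ⁻ (_ ∷ [])     (_ ∷ l) = Linked-∷ʳ⁻ [] l
  Linked-∷ʳ⁻ (_ ∷ y ∷ xs) (_ ∷ l) = Linked-∷ʳ⁻ (y ∷ xs) l

  Linked-init : ∀ {R : Rel A 0ℓ} xs {x} → Linked R (xs ∷ʳ x) → Linked R xs
  Linked-init []           _       = []
  Linked-init (_ ∷ [])     _       = [-]
  Linked-init (_ ∷ y ∷ xs) (r ∷ l) = r ∷ Linked-init (y ∷ xs) l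

  Linked-reverse : ∀ {R : Rel A 0ℓ} → Symmetric R → ∀ {xs} → Linked R xs → Linked R (reverse xs)
  Linked-reverse R-sym []  = []
  Linked-reverse R-sym [-] = [-]
  Linked-reverse {R} R-sym {x ∷ y ∷ xs} (r ∷ l) =
    subst (Linked R) (sym (unfold-reverse x (y ∷ xs)))
      (subst (λ zs → Linked R (zs ∷ʳ x)) (sym (unfold-reverse y xs))
        (Linked-∷ʳ⁺ (reverse xs) (subst (Linked R) (unfold-reverse y xs) (Linked-reverse R-sym l))
          (R-sym r)))

  module _ {R : Rel A 0ℓ} where

    Cyclic-step : ∀ x xs → Cyclic R (x ∷ xs) → Cyclic R (xs ∷ʳ x)
    Cyclic-step x []       l       = l
    Cyclic-step x (y ∷ xs) (r ∷ l) = Linked-∷ʳ⁺ (y ∷ xs) l r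

    Cyclic-map⁺ : ∀ {B : Set} {S : Rel B 0ℓ} (f : A → B) → (∀ {x y} → R x y → S (f x) (f y)) →
                  ∀ xs → Cyclic R xs → Cyclic S (map f xs)
    Cyclic-map⁺     f pres []       _ = _
    Cyclic-map⁺ {S = S} f pres (x ∷ xs) c = subst (Linked S) (map-++ f (x ∷ xs) [ x ])
      (Linked.map⁺ (Linked.map pres c))

    Cyclic-++ : ∀ as bs → Cyclic R (as ++ bs) → Cyclic R (bs ++ as)
    Cyclic-++ []       bs c = subst (Cyclic R) (sym (++-identityʳ bs)) c
    Cyclic-++ (a ∷ as) bs c = subst (Cyclic R) (++-assoc bs [ a ] as)
      (Cyclic-++ as (bs ∷ʳ a)
        (subst (Cyclic R) (++-assoc as bs [ a ]) (Cyclic-step a (as ++ bs) c)))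

    Cyclic-reverse : Symmetric R → ∀ xs → Cyclic R xs → Cyclic R (reverse xs)
    Cyclic-reverse R-sym []       c = c
    Cyclic-reverse R-sym (x ∷ xs) c = subst (Cyclic R) (sym (unfold-reverse x xs))
      (Cyclic-step x (reverse xs)
        (subst (Linked R)
          (trans (unfold-reverse x (xs ∷ʳ x)) (cong (_∷ʳ x) (reverse-++ xs [ x ])))
          (Linked-reverse R-sym c)))

    Cyclic-resp-≈ᶜ : Symmetric R → ∀ {C D} → C ≈ᶜ D → Cyclic R C → Cyclic R D
    Cyclic-resp-≈ᶜ R-sym (inj₁ (as , bs , refl , refl)) c = Cyclic-++ as bs c
    Cyclic-resp-≈ᶜ R-sym {C} (inj₂ (as , bs , eq , refl)) c =
      Cyclic-++ as bs (subst (Cyclic R) eq (Cyclic-reverse R-sym C c))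

  Rotation⇒↭ : ∀ {C D : List A} → Rotation C D → C ↭ D
  Rotation⇒↭ (as , bs , refl , refl) = ++-comm as bs

  ≈ᶜ⇒↭ : ∀ {C D : List A} → C ≈ᶜ D → C ↭ D
  ≈ᶜ⇒↭     (inj₁ r) = Rotation⇒↭ r
  ≈ᶜ⇒↭ {C} (inj₂ r) = ↭-trans (↭-sym (↭-reverse C)) (Rotation⇒↭ r)

  Unique-resp-↭ : ∀ {xs ys : List A} → xs ↭ ys → Unique xs → Unique ys
  Unique-resp-↭ p = SetoidPerm.Unique-resp-↭ (setoid A) (↭⇒↭ₛ p)

  -- Rotate `C` to start at `x`: then `y` is the second entry and `z` the last one. Reversing this
  -- rotation puts `z` right after `x`, and length at least three makes `y` and `z` different
  -- entries of a list without repetition.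
  cycle-neighbours :
    ∀ {R : Rel A 0ℓ} {C x} → 3 ≤ length C → Unique C → Cyclic R C → x ∈ₗ C →
    ∃₂ λ y z → y ≢ z × R x y × R z x ×
      (∃ λ ws → C ≈ᶜ x ∷ y ∷ ws) × (∃ λ ws → C ≈ᶜ x ∷ z ∷ ws)
  cycle-neighbours {R} {C} {x} len u c x∈C with as , bs , refl ← ∈-∃++ x∈C =
    go (bs ++ as) refl
      (subst (3 ≤_) (↭-length (Rotation⇒↭ rotated)) len)
      (Unique-resp-↭ (Rotation⇒↭ rotated) u)
      (Cyclic-++ as (x ∷ bs) c)
    where
    rotated : Rotation C (x ∷ bs ++ as)
    rotated = as , x ∷ bs , refl , refl
    reversed : ∀ y ws z → bs ++ as ≡ y ∷ ws ∷ʳ z → Rotation (reverse C) (x ∷ z ∷ reverse (y ∷ ws))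
    reversed y ws z eq = reverse bs , x ∷ reverse as
      , trans (reverse-++ as (x ∷ bs))
          (trans (cong (_++ reverse as) (unfold-reverse x bs)) (++-assoc (reverse bs) [ x ] (reverse as)))
      , cong (x ∷_) (trans (sym (reverse-++ (y ∷ ws) [ z ]))
          (trans (cong reverse (sym eq)) (reverse-++ bs as)))
    go : ∀ rest → bs ++ as ≡ rest → 3 ≤ length (x ∷ rest) → Unique (x ∷ rest) → Cyclic R (x ∷ rest) →
         ∃₂ λ y z → y ≢ z × R x y × R z x ×
           (∃ λ ws → C ≈ᶜ x ∷ y ∷ ws) × (∃ λ ws → C ≈ᶜ x ∷ z ∷ ws)
    go [] eq (s≤s ())
    go (y ∷ rest) eq len (_ ∷ y∉ ∷ _) (xy ∷ l) with initLast rest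
    go (y ∷ _) eq (s≤s (s≤s ())) _ _ | []
    go (y ∷ _) eq len (_ ∷ y∉ ∷ _) (xy ∷ l) | ws ∷ʳ′ z =
      y , z , All.lookup y∉ (∈-++⁺ʳ ws (here refl)) , xy , Linked-∷ʳ⁻ (y ∷ ws) l
      , (ws ∷ʳ z , inj₁ (subst (λ r → Rotation C (x ∷ r)) eq rotated))
      , (reverse (y ∷ ws) , inj₂ (reversed y ws z eq))

  unique-same-elements⇒length≡ : ∀ {xs ys : List A} → Unique xs → Unique ys →
                                 (∀ x → x ∈ₗ xs ⇔ x ∈ₗ ys) → length xs ≡ length ys
  unique-same-elements⇒length≡ u u′ same =
    ↭-length (∼bag⇒↭ (unique∧set⇒bag u u′ (λ {x} → same x)))

  unique⇒deduplicate≡ : (_≟_ : DecidableEquality A) → ∀ {xs} → Unique xs → deduplicate _≟_ xs ≡ xs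
  unique⇒deduplicate≡ _≟_ []       = refl
  unique⇒deduplicate≡ _≟_ {x ∷ xs} (x∉ ∷ u) rewrite unique⇒deduplicate≡ _≟_ u =
    cong (x ∷_) (filter-all (¬? ∘ (x ≟_)) x∉)

  concatMap-[]-applyUpTo : ∀ {B : Set} (h : B → A) (g : ℕ → B) n →
                           concatMap (λ i → [ h i ]) (applyUpTo g n) ≡ applyUpTo (h ∘ g) n
  concatMap-[]-applyUpTo h g zero    = refl
  concatMap-[]-applyUpTo h g (suc n) = cong (h (g 0) ∷_) (concatMap-[]-applyUpTo h (g ∘ suc) n)

  -- A list that `f` shifts by one place has each entry equal to `f` of the one before, so it runs
  -- through iterates of `f`, and `y` is the next iterate. The sequence `g` is kept abstract so that
  -- the induction can pass to `g ∘ suc`.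
  shifted⇒orbit : (f : A → A) (g : ℕ → A) → (∀ i → g (suc i) ≡ f (g i)) →
                  ∀ xs {y} → map f (g 0 ∷ xs) ≡ xs ∷ʳ y →
                  g 0 ∷ xs ≡ applyUpTo g (suc (length xs)) × y ≡ g (suc (length xs))
  shifted⇒orbit f g step []        eq = refl , trans (sym (proj₁ (∷-injective eq))) (sym (step 0))
  shifted⇒orbit f g step (x ∷ xs)  eq
    with fx≡ , rest ← ∷-injective eq
    with refl ← trans (sym fx≡) (sym (step 0))
    with xs≡ , y≡ ← shifted⇒orbit f (g ∘ suc) (step ∘ suc) xs rest
    = cong (g 0 ∷_) xs≡ , y≡

  -- A walk that never turns back, in a graph where the next node is determined by the
  -- last two, is determined by its first two nodes and its length.
  Linked-deterministic :
    ∀ {R : Rel A 0ℓ} → Symmetric R →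
    (∀ {x y z w} → R y x → R y z → R y w → x ≢ z → x ≢ w → z ≡ w) →
    ∀ a b xs ys → Linked R (a ∷ b ∷ xs) → Linked R (a ∷ b ∷ ys) →
    Unique (a ∷ b ∷ xs) → Unique (a ∷ b ∷ ys) →
    length xs ≡ length ys → xs ≡ ys
  Linked-deterministic R-sym det a b [] [] _ _ _ _ _ = refl
  Linked-deterministic R-sym det a b (x ∷ xs) (y ∷ ys) (ab ∷ bx ∷ l) (_ ∷ by ∷ l′)
    ((_ ∷ a≢x ∷ _) ∷ u) ((_ ∷ a≢y ∷ _) ∷ u′) len
    with refl ← det (R-sym ab) bx by a≢x a≢y
    = cong (x ∷_) (Linked-deterministic R-sym det b x xs ys (bx ∷ l) (by ∷ l′) u u′
        (ℕ.suc-injective len))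

-- Three-element index sets and enumerations of subsets.

third-index : ∀ (i j : Fin 3) → i ≢ j →
              ∃ λ k → k ≢ i × k ≢ j × (∀ l → l ≢ i → l ≢ j → l ≡ k)
third-index 0F 0F i≢j = contradiction refl i≢j
third-index 1F 1F i≢j = contradiction refl i≢j
third-index 2F 2F i≢j = contradiction refl i≢j
third-index 0F 1F _ = 2F , (λ ()) , (λ ()) , λ
  { 0F l≢i _ → contradiction refl l≢i ; 1F _ l≢j → contradiction refl l≢j ; 2F _ _ → refl }
third-index 1F 0F _ = 2F , (λ ()) , (λ ()) , λ
  { 1F l≢i _ → contradiction refl l≢i ; 0F _ l≢j → contradiction refl l≢j ; 2F _ _ → refl }
third-index 0F 2F _ = 1F , (λ ()) , (λ ()) , λ
  { 0F l≢i _ → contradiction refl l≢i ; 2F _ l≢j → contradiction refl l≢j ; 1F _ _ → refl }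
third-index 2F 0F _ = 1F , (λ ()) , (λ ()) , λ
  { 2F l≢i _ → contradiction refl l≢i ; 0F _ l≢j → contradiction refl l≢j ; 1F _ _ → refl }
third-index 1F 2F _ = 0F , (λ ()) , (λ ()) , λ
  { 1F l≢i _ → contradiction refl l≢i ; 2F _ l≢j → contradiction refl l≢j ; 0F _ _ → refl }
third-index 2F 1F _ = 0F , (λ ()) , (λ ()) , λ
  { 2F l≢i _ → contradiction refl l≢i ; 1F _ l≢j → contradiction refl l≢j ; 0F _ _ → refl }

module _ {p : ℕ} where

  opaque

    -- The size is a separate variable k, so that it can be matched away.
    nth : (s : Subset p) {k : ℕ} → ∣ s ∣ ≡ k → Fin k → Fin p
    nth s refl = elem s

    nth-∈ : ∀ s {k} (eq : ∣ s ∣ ≡ k) i → nth s eq i ∈ s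
    nth-∈ s refl = elem-∈ s

    nth-injective : ∀ s {k} (eq : ∣ s ∣ ≡ k) {i j} → nth s eq i ≡ nth s eq j → i ≡ j
    nth-injective s refl = elem-injective s

    nth-surjective : ∀ s {k} (eq : ∣ s ∣ ≡ k) {x} → x ∈ s → ∃ λ i → nth s eq i ≡ x
    nth-surjective s refl = elem-surjective s

-- Incidence of vertices, edges and faces.

module Geometry {p} (X : SimplicialSurface p) where
  open SimplicialSurface X
  open SurfaceProperties X
  open Surfaces X

  infix 4 _◁_ _≟ᵛ_

  -- A record, so that `v` and `F` can be inferred from a proof of incidence; `≼` unfolds to an
  -- inclusion of underlying subsets, which does not determine the cells for unification.
  record _◁_ (v : Vertex) (F : Face) : Set where
    constructor incident
    field point∈ : point v ∈ proj₁ F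
  open _◁_

  ◁⇒≼ : ∀ {v F} → v ◁ F → v ≼ F
  ◁⇒≼ {v} {F} (incident q) = ≼⁺ v F q

  ≼⇒◁ : ∀ {v F} → v ≼ F → v ◁ F
  ≼⇒◁ {v} {F} q = incident (≼⁻ v F q)

  point-vertex : ∀ {i} {x} (s : Cell i) (x∈s : x ∈ proj₁ s) → point (vertex s x∈s) ≡ x
  point-vertex {x = x} s x∈s = x∈⁅y⁆⇒x≡y x (point-∈ (vertex s x∈s))

  point-injective : ∀ {v w} → point v ≡ point w → v ≡ w
  point-injective {v} {w} eq = cell-≡ (trans (vertex-≡ v) (trans (cong ⁅_⁆ eq) (sym (vertex-≡ w))))

  _≟ᵛ_ : DecidableEquality Vertex
  v ≟ᵛ w = map′ point-injective (cong point) (point v Fin.≟ point w)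

  vertex-◁ : ∀ {i} {x} (s : Cell i) (x∈s : x ∈ proj₁ s) F → x ∈ proj₁ F → vertex s x∈s ◁ F
  vertex-◁ s x∈s F x∈F = incident (subst (_∈ proj₁ F) (sym (point-vertex s x∈s)) x∈F)

  -- One inclusion is enough because all faces have three elements.
  ◁-ext : ∀ {F G} → (∀ v → v ◁ F → v ◁ G) → F ≡ G
  ◁-ext {F} {G} sub = cell-⊆⇒≡ {s = F} {G} λ x∈F →
    subst (_∈ proj₁ G) (point-vertex F x∈F) (point∈ (sub (vertex F x∈F) (vertex-◁ F x∈F F x∈F)))

  private
    corner-∈ : (F : Face) (i : Fin 3) → nth (proj₁ F) (proj₂ (proj₂ F)) i ∈ proj₁ F
    corner-∈ F = nth-∈ (proj₁ F) (proj₂ (proj₂ F))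

  opaque
    corner : (F : Face) → Fin 3 → Vertex
    corner F i = vertex F (corner-∈ F i)

    corner-◁ : ∀ F i → corner F i ◁ F
    corner-◁ F i = vertex-◁ F (corner-∈ F i) F (corner-∈ F i)

    corner-injective : ∀ F {i j} → corner F i ≡ corner F j → i ≡ j
    corner-injective F {i} {j} eq = nth-injective (proj₁ F) (proj₂ (proj₂ F))
      (trans (sym (point-vertex F (corner-∈ F i))) (trans (cong point eq) (point-vertex F (corner-∈ F j))))

    corner-surjective : ∀ {v F} → v ◁ F → ∃ λ i → corner F i ≡ v
    corner-surjective {v} {F} (incident q) =
      let i , eq = nth-surjective (proj₁ F) (proj₂ (proj₂ F)) q
      in i , point-injective (trans (point-vertex F (corner-∈ F i)) eq)

  third : ∀ {F a b} → a ◁ F → b ◁ F → a ≢ b →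
          ∃ λ c → c ◁ F × c ≢ a × c ≢ b × (∀ {d} → d ◁ F → d ≢ a → d ≢ b → d ≡ c)
  third {F} a◁F b◁F a≢b
    with i , refl ← corner-surjective a◁F
       | j , refl ← corner-surjective b◁F
    with k , k≢i , k≢j , only ← third-index i j (λ { refl → a≢b refl })
    = corner F k , corner-◁ F k , k≢i ∘ corner-injective F , k≢j ∘ corner-injective F , rest
    where
    rest : ∀ {d} → d ◁ F → d ≢ corner F i → d ≢ corner F j → d ≡ corner F k
    rest d◁F d≢a d≢b with l , refl ← corner-surjective d◁F =
      cong (corner F) (only l (λ { refl → d≢a refl }) (λ { refl → d≢b refl }))

  face-≡ : ∀ {F G a b c} → a ≢ b → c ≢ a → c ≢ b → a ◁ F → b ◁ F → c ◁ F →
           a ◁ G → b ◁ G → c ◁ G → F ≡ G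
  face-≡ {F} {G} {a} {b} a≢b c≢a c≢b a◁F b◁F c◁F a◁G b◁G c◁G
    with c′ , _ , _ , _ , only ← third a◁F b◁F a≢b
    = ◁-ext sub
    where
    sub : ∀ v → v ◁ F → v ◁ G
    sub v v◁F with v ≟ᵛ a | v ≟ᵛ b
    ... | yes refl | _        = a◁G
    ... | no  _    | yes refl = b◁G
    ... | no  v≢a  | no  v≢b  =
      subst (_◁ G) (trans (only c◁F c≢a c≢b) (sym (only v◁F v≢a v≢b))) c◁G

  opaque
    -- The edge is `F` with its third vertex `c` removed. The last component identifies it
    -- independently of `F`: every face through `a` and `b` contains it.
    side : ∀ {F a b} → a ◁ F → b ◁ F → a ≢ b →
           ∃ λ (e : Edge) → e ≼ F × point a ∈ proj₁ e × point b ∈ proj₁ e ×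
             (∀ {G} → a ◁ G → b ◁ G → e ≼ G)
    side {F} {a} {b} a◁F b◁F a≢b
      with c , c◁F , c≢a , c≢b , only ← third a◁F b◁F a≢b
      = (proj₁ F - point c , closed _ _ e⊆F (proj₁ (proj₂ F))
          , ℕ.suc-injective (trans (∣s-x∣ (proj₁ F) (point∈ c◁F)) (proj₂ (proj₂ F))))
        , e⊆F
        , x∈p∧x≢y⇒x∈p-y (point∈ a◁F) (λ eq → c≢a (point-injective (sym eq)))
        , x∈p∧x≢y⇒x∈p-y (point∈ b◁F) (λ eq → c≢b (point-injective (sym eq)))
        , λ {G} → e≼ {G}
      where
      e⊆F : proj₁ F - point c ⊆ proj₁ F
      e⊆F = p─q⊆p (proj₁ F) ⁅ point c ⁆
      e≼ : ∀ {G} → a ◁ G → b ◁ G → proj₁ F - point c ⊆ proj₁ G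
      e≼ {G} a◁G b◁G {x} x∈e = subst (_∈ proj₁ G) (point-vertex F x∈F) (point∈ w◁G)
        where
        x∈F : x ∈ proj₁ F
        x∈F = e⊆F x∈e
        w : Vertex
        w = vertex F x∈F
        w≢c : w ≢ c
        w≢c refl = x∉s-x (proj₁ F) x
          (subst (λ y → x ∈ proj₁ F - y) (point-vertex F x∈F) x∈e)
        w◁G : w ◁ G
        w◁G with w ≟ᵛ a | w ≟ᵛ b
        ... | yes w≡a | _       = subst (_◁ G) (sym w≡a) a◁G
        ... | no  _   | yes w≡b = subst (_◁ G) (sym w≡b) b◁G
        ... | no  w≢a | no  w≢b = contradiction (only (vertex-◁ F x∈F F x∈F) w≢a w≢b) w≢c

  opaque
    -- The side through `a` and `b` lies in exactly two faces, one of which is `F`.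
    across : ∀ {F a b} → a ◁ F → b ◁ F → a ≢ b →
             ∃ λ G → F ≢ G × a ◁ G × b ◁ G × (∀ {L} → F ≢ L → a ◁ L → b ◁ L → L ≡ G)
    across {F} a◁F b◁F a≢b =
      let e , e≼F , a∈e , b∈e , e≼ = side a◁F b◁F a≢b
          G , F≢G , e≼G , only     = otherFace e F (λ {x} → e≼F {x})
      in G , F≢G , incident (e≼G a∈e) , incident (e≼G b∈e)
       , λ {L} F≢L a◁L b◁L → only L F≢L (λ {x} → e≼ {L} a◁L b◁L {x})

  across-unique : ∀ {F G L a b} → a ≢ b → a ◁ F → b ◁ F → F ≢ G → a ◁ G → b ◁ G →
                  F ≢ L → a ◁ L → b ◁ L → G ≡ L
  across-unique a≢b a◁F b◁F F≢G a◁G b◁G F≢L a◁L b◁L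
    with _ , _ , _ , _ , only ← across a◁F b◁F a≢b
    = trans (only F≢G a◁G b◁G) (sym (only F≢L a◁L b◁L))

  opaque
    Adjacent⁺ : ∀ {F G a b} → F ≢ G → a ≢ b → a ◁ F → b ◁ F → a ◁ G → b ◁ G → Adjacent F G
    Adjacent⁺ {F} {G} F≢G a≢b a◁F b◁F a◁G b◁G =
      let e , e≼F , _ , _ , e≼ = side a◁F b◁F a≢b in
      F≢G , e , (λ {x} → e≼F {x}) , (λ {x} → e≼ {G} a◁G b◁G {x})

  Common : Face → Face → Set
  Common F G = ∃₂ λ a b → a ≢ b × a ◁ F × b ◁ F × a ◁ G × b ◁ G

  opaque
    common : ∀ {F G} (s : Subset p) → ∣ s ∣ ≡ 2 → s ⊆ proj₁ F → s ⊆ proj₁ G → Common F G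
    common {F} {G} s eq s⊆F s⊆G =
      vertex F (at zero) , vertex F (at (suc zero)) , distinct
      , vertex-◁ F _ F (at zero) , vertex-◁ F _ F (at (suc zero))
      , vertex-◁ F _ G (s⊆G (nth-∈ s eq _)) , vertex-◁ F _ G (s⊆G (nth-∈ s eq _))
      where
      at : ∀ i → nth s eq i ∈ proj₁ F
      at i = s⊆F (nth-∈ s eq i)
      distinct : vertex F (at zero) ≢ vertex F (at (suc zero))
      distinct eq′ with () ← nth-injective s eq {zero} {suc zero}
        (trans (sym (point-vertex F (at zero))) (trans (cong point eq′) (point-vertex F (at (suc zero)))))

  opaque
    Adjacent⁻ : ∀ {F G} → Adjacent F G → Common F G
    Adjacent⁻ (_ , (s , _ , eq) , e≼F , e≼G) = common s eq e≼F e≼G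

    ∩-Adjacent : ∀ {F G} → ∣ proj₁ F ∩ proj₁ G ∣ ≡ 2 → Adjacent F G
    ∩-Adjacent {F} {G} eq =
      let _ , _ , a≢b , a◁F , b◁F , a◁G , b◁G = shared in
      Adjacent⁺ F≢G a≢b a◁F b◁F a◁G b◁G
      where
      shared : Common F G
      shared = common (proj₁ F ∩ proj₁ G) eq (proj₁ ∘ x∈p∩q⁻ _ _) (proj₂ ∘ x∈p∩q⁻ _ _)
      F≢G : F ≢ G
      F≢G refl with () ← trans (sym eq) (trans (cong ∣_∣ (∩-idem (proj₁ F))) (proj₂ (proj₂ F)))

  Adjacent-sym : Symmetric Adjacent
  Adjacent-sym (F≢G , e , e≼F , e≼G) = F≢G ∘ sym , e , (λ {x} → e≼G {x}) , (λ {x} → e≼F {x})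

  mate : ∀ {F G v} → Adjacent F G → ∃ λ a → a ≢ v × a ◁ F × a ◁ G
  mate {F} {G} {v} adj = pick (Adjacent⁻ adj)
    where
    pick : Common F G → ∃ λ a → a ≢ v × a ◁ F × a ◁ G
    pick (a , b , a≢b , a◁F , b◁F , a◁G , b◁G) with a ≟ᵛ v
    ... | no  a≢v = a , a≢v , a◁F , a◁G
    ... | yes a≡v = b , (λ b≡v → a≢b (trans a≡v (sym b≡v))) , b◁F , b◁G

  -- A third common vertex would make the two faces equal.
  common-only : ∀ {F G a b c} → F ≢ G → a ≢ b → a ◁ F → b ◁ F → a ◁ G → b ◁ G →
                c ◁ F → c ◁ G → c ≡ a ⊎ c ≡ b
  common-only {a = a} {b} {c} F≢G a≢b a◁F b◁F a◁G b◁G c◁F c◁G with c ≟ᵛ a | c ≟ᵛ b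
  ... | yes c≡a | _       = inj₁ c≡a
  ... | no  _   | yes c≡b = inj₂ c≡b
  ... | no  c≢a | no  c≢b = contradiction (face-≡ a≢b c≢a c≢b a◁F b◁F c◁F a◁G b◁G c◁G) F≢G

-- Faces around a vertex and uniqueness of its umbrella.

module Umbrellas {p} (X : SimplicialSurface p) where
  open SimplicialSurface X
  open SurfaceProperties X
  open Surfaces X
  open Geometry X

  private
    -- Enlarge `s` while possible; a set that admits no enlargement is maximal, hence a face by
    -- purity. The number `k` bounds the remaining enlargements, since no subset has more than `p`
    -- elements.
    grow : ∀ k s → p ≤ k + ∣ s ∣ → T (contains s) → ∃ λ (F : Face) → s ⊆ proj₁ F
    grow k s p≤ s∈ with anySubset? (λ t → T? (contains t) ×-dec (s ⊆? t) ×-dec (∣ s ∣ ℕ.<? ∣ t ∣))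
    ... | no none = (s , s∈ , pure s s∈ maximal) , λ q → q
      where
      maximal : ∀ t → T (contains t) → s ⊆ t → s ≡ t
      maximal t t∈ s⊆t = ⊆∧∣∣≡⇒≡ s⊆t
        (ℕ.≤-antisym (p⊆q⇒∣p∣≤∣q∣ s⊆t) (ℕ.≮⇒≥ λ s<t → none (t , t∈ , (λ {x} → s⊆t {x}) , s<t)))
    grow zero    s p≤ s∈ | yes (t , _ , _ , s<t) =
      contradiction s<t (ℕ.≤⇒≯ (ℕ.≤-trans (∣p∣≤n t) p≤))
    grow (suc k) s p≤ s∈ | yes (t , t∈ , s⊆t , s<t) =
      let F , t⊆F = grow k t (ℕ.≤-trans p≤ (ℕ.≤-trans (ℕ.≤-reflexive (sym (ℕ.+-suc k ∣ s ∣)))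
                                                      (ℕ.+-monoʳ-≤ k s<t))) t∈
      in F , λ q → t⊆F (s⊆t q)

  opaque
    face-above : ∀ s → T (contains s) → ∃ λ (F : Face) → s ⊆ proj₁ F
    face-above s = grow p s (ℕ.m≤m+n p ∣ s ∣)

    face-at : ∀ v → ∃ λ F → v ◁ F
    face-at v = let F , v⊆F = face-above (proj₁ v) (proj₁ (proj₂ v)) in F , ≼⇒◁ {v} {F} v⊆F

    some-face : Face
    some-face = proj₁ (face-above (proj₁ nonempty) (proj₂ nonempty))

  another : ∀ F v → ∃ λ a → a ◁ F × a ≢ v
  another F v with corner F 0F ≟ᵛ v
  ... | no  c≢v = corner F 0F , corner-◁ F 0F , c≢v
  ... | yes refl = corner F 1F , corner-◁ F 1F , λ eq → contradiction (corner-injective F eq) λ ()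

  -- Otherwise take a face with vertices `v`, `w`, `a` and cross its side `va`: the face reached
  -- would contain `w` as well, so it would be the face just left.
  vertex-≡-from-faces : ∀ {v w} → (∀ F → v ◁ F → w ◁ F) → v ≡ w
  vertex-≡-from-faces {v} {w} sub with v ≟ᵛ w
  ... | yes v≡w = v≡w
  ... | no  v≢w =
    let F , v◁F                   = face-at v
        a , a◁F , a≢v , a≢w , _   = third v◁F (sub F v◁F) v≢w
        G , F≢G , v◁G , a◁G , _   = across v◁F a◁F (≢-sym a≢v)
    in contradiction (face-≡ v≢w a≢v a≢w v◁F (sub F v◁F) a◁F v◁G (sub G v◁G) a◁G) F≢G

  record Next (v : Vertex) (F G : Face) : Set where
    constructor next
    field
      source   : v ◁ F
      target   : v ◁ G
      adjacent : Adjacent F G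
  open Next

  Next-sym : ∀ {v} → Symmetric (Next v)
  Next-sym (next v◁F v◁G adj) = next v◁G v◁F (Adjacent-sym adj)

  -- A neighbour of `F` around `v` is determined by the vertex other than `v` that it shares with
  -- `F`, and `F` has only two such vertices.
  two-neighbours : ∀ {v F A B G} → Next v F A → Next v F B → A ≢ B → Next v F G → G ≡ A ⊎ G ≡ B
  two-neighbours {v} {F} {A} {B} {G} (next v◁F v◁A FA) (next _ v◁B FB) A≢B (next _ v◁G FG)
    = compare (mate FA) (mate FB) (mate FG)
    where
    Mate : Face → Set
    Mate L = ∃ λ a → a ≢ v × a ◁ F × a ◁ L
    same : ∀ {L M a b} → Adjacent F L → Adjacent F M → v ◁ L → v ◁ M →
           a ≢ v → a ◁ F → a ◁ L → b ◁ M → b ≡ a → M ≡ L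
    same FL FM v◁L v◁M a≢v a◁F a◁L a◁M refl =
      across-unique (≢-sym a≢v) v◁F a◁F (proj₁ FM) v◁M a◁M (proj₁ FL) v◁L a◁L
    compare : Mate A → Mate B → Mate G → G ≡ A ⊎ G ≡ B
    compare (a , a≢v , a◁F , a◁A) (b , b≢v , b◁F , b◁B) (c , c≢v , c◁F , c◁G) with c ≟ᵛ a | c ≟ᵛ b
    ... | yes c≡a | _       = inj₁ (same FA FG v◁A v◁G a≢v a◁F a◁A c◁G c≡a)
    ... | no  _   | yes c≡b = inj₂ (same FB FG v◁B v◁G b≢v b◁F b◁B c◁G c≡b)
    ... | no  c≢a | no  c≢b =
      let d , _ , _ , _ , only = third v◁F a◁F (≢-sym a≢v)
          b≢a : b ≢ a
          b≢a b≡a = A≢B (sym (same FA FB v◁A v◁B a≢v a◁F a◁A b◁B b≡a))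
      in contradiction (trans (only c◁F c≢v c≢a) (sym (only b◁F b≢v b≢a))) c≢b

  next-unique : ∀ {v F G L M} → Next v G F → Next v G L → Next v G M → F ≢ L → F ≢ M → L ≡ M
  next-unique GF GL GM F≢L F≢M =
    [ (λ M≡F → contradiction (sym M≡F) F≢M) , sym ]′ (two-neighbours GF GL F≢L GM)

  -- Cross the two sides of `F` at `v`. If both led to the same face, it would contain all three
  -- vertices of `F`.
  two-nexts : ∀ {v F} → v ◁ F → ∃₂ λ A B → A ≢ B × Next v F A × Next v F B
  two-nexts {v} {F} v◁F =
    let a , a◁F , a≢v             = another F v
        b , b◁F , b≢v , b≢a , _   = third v◁F a◁F (≢-sym a≢v)
        A , F≢A , v◁A , a◁A , _   = across v◁F a◁F (≢-sym a≢v)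
        B , F≢B , v◁B , b◁B , _   = across v◁F b◁F (≢-sym b≢v)
    in A , B
     , (λ A≡B → F≢A (face-≡ (≢-sym a≢v) b≢v b≢a v◁F a◁F b◁F v◁A a◁A (subst (b ◁_) (sym A≡B) b◁B)))
     , next v◁F v◁A (Adjacent⁺ F≢A (≢-sym a≢v) v◁F a◁F v◁A a◁A)
     , next v◁F v◁B (Adjacent⁺ F≢B (≢-sym b≢v) v◁F b◁F v◁B b◁B)

  -- Unlike `Umbrella`, a property of a given list, stated with the symmetric relation `Next v`, so
  -- that it can be carried along `≈ᶜ` and along automorphisms.
  record IsUmbrella (v : Vertex) (C : List Face) : Set where
    field
      unique   : Unique C
      complete : ∀ F → F ∈ₗ C ⇔ v ◁ F
      cyclic   : Cyclic (Next v) C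
  open IsUmbrella

  IsUmbrella-resp-≈ᶜ : ∀ {v C D} → C ≈ᶜ D → IsUmbrella v C → IsUmbrella v D
  IsUmbrella-resp-≈ᶜ C≈D u = record
    { unique   = Unique-resp-↭ (≈ᶜ⇒↭ C≈D) (unique u)
    ; complete = λ F → mk⇔
        (Equivalence.to (complete u F) ∘ ∈-resp-↭ (↭-sym (≈ᶜ⇒↭ C≈D)))
        (∈-resp-↭ (≈ᶜ⇒↭ C≈D) ∘ Equivalence.from (complete u F))
    ; cyclic   = Cyclic-resp-≈ᶜ Next-sym C≈D (cyclic u)
    }

  IsUmbrella-vertex : ∀ {v w C} → IsUmbrella v C → IsUmbrella w C → v ≡ w
  IsUmbrella-vertex u u′ = vertex-≡-from-faces λ F →
    Equivalence.to (complete u′ F) ∘ Equivalence.from (complete u F)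

  module _ {v : Vertex} (u : Umbrella v) where

    private
      lies-on : ∀ {F} → F ∈ₗ Umbrella.faces u → v ◁ F
      lies-on {F} F∈ = ≼⇒◁ {v} {F} (Equivalence.to (Umbrella.complete u F) F∈)

    umbrella-isUmbrella : IsUmbrella v (Umbrella.faces u)
    umbrella-isUmbrella = record
      { unique   = Umbrella.unique u
      ; complete = λ F → mk⇔ lies-on (λ v◁F → Equivalence.from (Umbrella.complete u F) (◁⇒≼ v◁F))
      ; cyclic   = cyc (Umbrella.faces u) lies-on (Umbrella.cyclic u)
      }
      where
      link : ∀ xs → (∀ {F} → F ∈ₗ xs → v ◁ F) →
             Linked (λ F G → ∣ proj₁ F ∩ proj₁ G ∣ ≡ 2) xs → Linked (Next v) xs
      link []           _   _       = []
      link (_ ∷ [])     _   _       = [-]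
      link (_ ∷ _ ∷ xs) v◁_ (r ∷ l) =
        next (v◁ here refl) (v◁ there (here refl)) (∩-Adjacent r) ∷ link (_ ∷ xs) (v◁_ ∘ there) l
      cyc : ∀ xs → (∀ {F} → F ∈ₗ xs → v ◁ F) →
            Cyclic (λ F G → ∣ proj₁ F ∩ proj₁ G ∣ ≡ 2) xs → Cyclic (Next v) xs
      cyc []       _   _ = _
      cyc (x ∷ xs) v◁_ l = link (x ∷ xs ∷ʳ x) closing l
        where
        closing : ∀ {F} → F ∈ₗ x ∷ xs ∷ʳ x → v ◁ F
        closing F∈ with ∈-++⁻ (x ∷ xs) F∈
        ... | inj₁ F∈′         = v◁ F∈′
        ... | inj₂ (here refl) = v◁ here refl

  -- A single face would be adjacent to itself, and with two faces each would have only one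
  -- neighbour around `v`, against `two-nexts`.
  IsUmbrella⇒length≥3 : ∀ {v C} → IsUmbrella v C → 3 ≤ length C
  IsUmbrella⇒length≥3 {v} {[]} u =
    let F , v◁F = face-at v in contradiction (Equivalence.from (complete u F) v◁F) λ ()
  IsUmbrella⇒length≥3 {v} {F ∷ []} u = contradiction refl (proj₁ (adjacent (Linked.head (cyclic u))))
  IsUmbrella⇒length≥3 {v} {F ∷ G ∷ []} u =
    let A , B , A≢B , FA , FB = two-nexts (Equivalence.to (complete u F) (here refl))
    in contradiction (trans (only FA) (sym (only FB))) A≢B
    where
    only : ∀ {L} → Next v F L → L ≡ G
    only {L} (next _ v◁L (F≢L , _)) = pick (Equivalence.from (complete u L) v◁L)
      where
      pick : L ∈ₗ F ∷ G ∷ [] → L ≡ G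
      pick (here L≡F)         = contradiction (sym L≡F) F≢L
      pick (there (here L≡G)) = L≡G
  IsUmbrella⇒length≥3 {C = _ ∷ _ ∷ _ ∷ _} u = s≤s (s≤s (s≤s z≤n))

  -- The predecessor and the successor of `F` on `C` are distinct neighbours of `F` around `v`, so
  -- `G` is one of them.
  Next⇒consecutive : ∀ {v C F G} → IsUmbrella v C → Next v F G → ∃ λ ws → C ≈ᶜ F ∷ G ∷ ws
  Next⇒consecutive {v} {C} {F} {G} u FG =
    let A , B , A≢B , FA , BF , atA , atB =
          cycle-neighbours (IsUmbrella⇒length≥3 u) (unique u) (cyclic u)
            (Equivalence.from (complete u F) (source FG))
    in [ (λ G≡A → subst (λ L → ∃ λ ws → C ≈ᶜ F ∷ L ∷ ws) (sym G≡A) atA)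
       , (λ G≡B → subst (λ L → ∃ λ ws → C ≈ᶜ F ∷ L ∷ ws) (sym G≡B) atB)
       ]′ (two-neighbours FA (Next-sym BF) A≢B FG)

  consecutive⇒Next : ∀ {v C F G ws} → IsUmbrella v C → C ≈ᶜ F ∷ G ∷ ws → Next v F G
  consecutive⇒Next u C≈ = Linked.head (cyclic (IsUmbrella-resp-≈ᶜ C≈ u))

  same-start⇒≡ : ∀ {v F G xs ys} → IsUmbrella v (F ∷ G ∷ xs) → IsUmbrella v (F ∷ G ∷ ys) → xs ≡ ys
  same-start⇒≡ {F = F} {G} {xs} {ys} u u′ =
    Linked-deterministic Next-sym next-unique F G xs ys
      (Linked-init (F ∷ G ∷ xs) (cyclic u)) (Linked-init (F ∷ G ∷ ys) (cyclic u′))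
      (unique u) (unique u′)
      (ℕ.suc-injective (ℕ.suc-injective (unique-same-elements⇒length≡ (unique u) (unique u′)
        λ L → mk⇔ (Equivalence.from (complete u′ L) ∘ Equivalence.to (complete u L))
                  (Equivalence.from (complete u L) ∘ Equivalence.to (complete u′ L)))))

  -- The first two faces of `D` are consecutive on `C` too, so `C` can be rotated and possibly
  -- reversed to start with them; the rest of the walk around `v` is then forced.
  IsUmbrella-unique : ∀ {v C D} → IsUmbrella v C → IsUmbrella v D → C ≈ᶜ D
  IsUmbrella-unique {D = []}     u u′ = contradiction (IsUmbrella⇒length≥3 u′) λ ()
  IsUmbrella-unique {D = F ∷ []} u u′ = contradiction (IsUmbrella⇒length≥3 u′) λ { (s≤s ()) }
  IsUmbrella-unique {C = C} {D = F ∷ G ∷ ws} u u′ =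
    let ws′ , C≈ = Next⇒consecutive u (Linked.head (cyclic u′))
    in subst (λ r → C ≈ᶜ F ∷ G ∷ r) (same-start⇒≡ (IsUmbrella-resp-≈ᶜ C≈ u) u′) C≈

-- The action of automorphisms on incidence and umbrellas.

module Automorphisms {p} (X : SimplicialSurface p) where
  open SimplicialSurface X
  open SurfaceProperties X
  open Surfaces X
  open Geometry X
  open Umbrellas X
  open IsUmbrella
  open Next
  open Group Aut public using (_∙_; _⁻¹)
    renaming (Carrier to Automorphism; _≈_ to _≈ᵃ_; ε to idᵃ)

  opaque
    ·-◁ : ∀ φ {v F} → v ◁ F → φ ·ᵛ v ◁ φ ·ᶠ F
    ·-◁ φ {v} {F} v◁F = ≼⇒◁ {φ ·ᵛ v} {φ ·ᶠ F} (Equivalence.to (·ᶠ-image φ F v) (◁⇒≼ {v} {F} v◁F))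

    ·-◁⁻ : ∀ φ {v F} → φ ·ᵛ v ◁ φ ·ᶠ F → v ◁ F
    ·-◁⁻ φ {v} {F} q = ≼⇒◁ {v} {F} (Equivalence.from (·ᶠ-image φ F v) (◁⇒≼ {φ ·ᵛ v} {φ ·ᶠ F} q))

    ·-Adjacent : ∀ φ {F G} → Adjacent F G → Adjacent (φ ·ᶠ F) (φ ·ᶠ G)
    ·-Adjacent φ {F} {G} = Equivalence.to (proj₂ (λX φ) F G)

    ·ᵛ-inverseʳ : ∀ φ v → φ ·ᵛ (φ ⁻¹) ·ᵛ v ≡ v
    ·ᵛ-inverseʳ φ = Inverse.strictlyInverseˡ (proj₁ φ)

    ·ᵛ-injective : ∀ φ {v w} → φ ·ᵛ v ≡ φ ·ᵛ w → v ≡ w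
    ·ᵛ-injective φ {v} {w} eq = trans (sym (Inverse.strictlyInverseʳ (proj₁ φ) v))
      (trans (cong ((φ ⁻¹) ·ᵛ_) eq) (Inverse.strictlyInverseʳ (proj₁ φ) w))

    ·ᶠ-injective : ∀ φ {F G} → φ ·ᶠ F ≡ φ ·ᶠ G → F ≡ G
    ·ᶠ-injective φ {F} {G} eq =
      trans (sym (·ᶠ-inverseˡ φ F)) (trans (cong ((φ ⁻¹) ·ᶠ_) eq) (·ᶠ-inverseˡ φ G))

    ∙-·ᶠ : ∀ φ ψ F → (φ ∙ ψ) ·ᶠ F ≡ φ ·ᶠ ψ ·ᶠ F
    ∙-·ᶠ φ ψ F = refl

  ·-IsUmbrella : ∀ φ {v C} → IsUmbrella v C → IsUmbrella (φ ·ᵛ v) (map (φ ·ᶠ_) C)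
  ·-IsUmbrella φ {v} {C} u = record
    { unique   = Unique.map⁺ (·ᶠ-injective φ) (unique u)
    ; complete = λ F → mk⇔ (image F) (preimage F)
    ; cyclic   = Cyclic-map⁺ (φ ·ᶠ_) ·-Next C (cyclic u)
    }
    where
    ·-Next : ∀ {F G} → Next v F G → Next (φ ·ᵛ v) (φ ·ᶠ F) (φ ·ᶠ G)
    ·-Next (next v◁F v◁G adj) = next (·-◁ φ v◁F) (·-◁ φ v◁G) (·-Adjacent φ adj)
    image : ∀ F → F ∈ₗ map (φ ·ᶠ_) C → φ ·ᵛ v ◁ F
    image F F∈ = let G , G∈ , F≡ = ∈-map⁻ (φ ·ᶠ_) F∈ in
      subst (φ ·ᵛ v ◁_) (sym F≡) (·-◁ φ (Equivalence.to (complete u G) G∈))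
    preimage : ∀ F → φ ·ᵛ v ◁ F → F ∈ₗ map (φ ·ᶠ_) C
    preimage F φv◁F = subst (_∈ₗ map (φ ·ᶠ_) C) (·ᶠ-inverseʳ φ F)
      (∈-map⁺ (φ ·ᶠ_) (Equivalence.from (complete u _)
        (·-◁⁻ φ (subst (φ ·ᵛ v ◁_) (sym (·ᶠ-inverseʳ φ F)) φv◁F))))

  -- Flags and rigidity.

  record Flag (F : Face) (a b : Vertex) : Set where
    constructor flag
    field
      on₁      : a ◁ F
      on₂      : b ◁ F
      distinct : a ≢ b

  ·-Flag : ∀ φ {F a b} → Flag F a b → Flag (φ ·ᶠ F) (φ ·ᵛ a) (φ ·ᵛ b)
  ·-Flag φ (flag a◁F b◁F a≢b) = flag (·-◁ φ a◁F) (·-◁ φ b◁F) (a≢b ∘ ·ᵛ-injective φ)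

  record AgreeOn (φ ψ : Automorphism) (F : Face) : Set where
    constructor agreement
    field
      on-face     : φ ·ᶠ F ≡ ψ ·ᶠ F
      on-vertices : ∀ {v} → v ◁ F → φ ·ᵛ v ≡ ψ ·ᵛ v
  open AgreeOn

  module _ (φ ψ : Automorphism) where

    agree-on-flag : ∀ {F a b} → Flag F a b → φ ·ᶠ F ≡ ψ ·ᶠ F → φ ·ᵛ a ≡ ψ ·ᵛ a → φ ·ᵛ b ≡ ψ ·ᵛ b →
                    AgreeOn φ ψ F
    agree-on-flag {F} {a} {b} (flag a◁F b◁F a≢b) φF≡ φa≡ φb≡ = agreement φF≡ vertices
      where
      vertices : ∀ {v} → v ◁ F → φ ·ᵛ v ≡ ψ ·ᵛ v
      vertices {v} v◁F = compare (v ≟ᵛ a) (v ≟ᵛ b)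
        where
        -- The vertex that `ψ` sends to `φ ·ᵛ v`. It lies on `F`, and if `v` is neither `a` nor `b`,
        -- then neither is `w`, because `φ` and `ψ` agree there; so both are the third vertex.
        w : Vertex
        w = (ψ ⁻¹) ·ᵛ φ ·ᵛ v
        ψw≡φv : ψ ·ᵛ w ≡ φ ·ᵛ v
        ψw≡φv = ·ᵛ-inverseʳ ψ (φ ·ᵛ v)
        w◁F : w ◁ F
        w◁F = ·-◁⁻ ψ (subst (_◁ ψ ·ᶠ F) (sym ψw≡φv) (subst (φ ·ᵛ v ◁_) φF≡ (·-◁ φ v◁F)))
        avoids : ∀ {c} → φ ·ᵛ c ≡ ψ ·ᵛ c → v ≢ c → w ≢ c
        avoids φc≡ v≢c w≡c = v≢c (·ᵛ-injective φ
          (trans (sym ψw≡φv) (trans (cong (ψ ·ᵛ_) w≡c) (sym φc≡))))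
        compare : Dec (v ≡ a) → Dec (v ≡ b) → φ ·ᵛ v ≡ ψ ·ᵛ v
        compare (yes v≡a) _ = trans (cong (φ ·ᵛ_) v≡a) (trans φa≡ (cong (ψ ·ᵛ_) (sym v≡a)))
        compare (no _) (yes v≡b) = trans (cong (φ ·ᵛ_) v≡b) (trans φb≡ (cong (ψ ·ᵛ_) (sym v≡b)))
        compare (no v≢a) (no v≢b) =
          let c , _ , _ , _ , only = third a◁F b◁F a≢b
              w≡v = trans (only w◁F (avoids φa≡ v≢a) (avoids φb≡ v≢b)) (sym (only v◁F v≢a v≢b))
          in trans (sym ψw≡φv) (cong (ψ ·ᵛ_) w≡v)

    -- The images of `G` under `φ` and `ψ` both lie across the same side of the same face, namely
    -- the common image of the shared edge, and so coincide.
    agree-across : ∀ {F G} → Adjacent F G → AgreeOn φ ψ F → AgreeOn φ ψ G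
    agree-across {F} {G} FG agree =
      let a , b , a≢b , a◁F , b◁F , a◁G , b◁G = Adjacent⁻ FG
          φa≡ = on-vertices agree a◁F
          φb≡ = on-vertices agree b◁F
      in agree-on-flag (flag a◁G b◁G a≢b)
           (across-unique (a≢b ∘ ·ᵛ-injective φ)
             (·-◁ φ a◁F) (·-◁ φ b◁F)
             (proj₁ FG ∘ ·ᶠ-injective φ) (·-◁ φ a◁G) (·-◁ φ b◁G)
             (λ φF≡ψG → proj₁ FG (·ᶠ-injective ψ (trans (sym (on-face agree)) φF≡ψG)))
             (subst (_◁ ψ ·ᶠ G) (sym φa≡) (·-◁ ψ a◁G)) (subst (_◁ ψ ·ᶠ G) (sym φb≡) (·-◁ ψ b◁G)))
           φa≡ φb≡

    agree-everywhere : ∀ {F G} → Star Adjacent F G → AgreeOn φ ψ F → AgreeOn φ ψ G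
    agree-everywhere ε           agree = agree
    agree-everywhere (FF′ ◅ path) agree = agree-everywhere path (agree-across FF′ agree)

    rigid : ∀ {F a b} → Flag F a b → φ ·ᶠ F ≡ ψ ·ᶠ F → φ ·ᵛ a ≡ ψ ·ᵛ a → φ ·ᵛ b ≡ ψ ·ᵛ b → φ ≈ᵃ ψ
    rigid {F} fl φF≡ φa≡ φb≡ v =
      let G , v◁G = face-at v
      in on-vertices (agree-everywhere (face-graph-connected F G) (agree-on-flag fl φF≡ φa≡ φb≡)) v◁G

    -- A vertex is determined by the faces through it.
    λX-injective : (∀ F → φ ·ᶠ F ≡ ψ ·ᶠ F) → φ ≈ᵃ ψ
    λX-injective eq v = vertex-≡-from-faces λ L φv◁L →
      let F   = (φ ⁻¹) ·ᶠ L
          φF≡L = ·ᶠ-inverseʳ φ L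
          v◁F = ·-◁⁻ φ (subst (φ ·ᵛ v ◁_) (sym φF≡L) φv◁L)
      in subst (ψ ·ᵛ v ◁_) (trans (sym (eq F)) φF≡L) (·-◁ ψ v◁F)

  -- The six flags of a face, and stabilisers.

  opaque
    -- An index in `Fin 6` splits into `i` in `Fin 3` for the first corner and `j` in `Fin 2` for
    -- the second, where `punchIn i` skips the corner already used.
    pair : Face → Fin 6 → Vertex × Vertex
    pair F k = let i , j = remQuot {3} 2 k in corner F i , corner F (punchIn i j)

    pair-flag : ∀ F k → Flag F (proj₁ (pair F k)) (proj₂ (pair F k))
    pair-flag F k = let i , j = remQuot {3} 2 k in
      flag (corner-◁ F i) (corner-◁ F (punchIn i j)) (Fin.punchInᵢ≢i i j ∘ sym ∘ corner-injective F)

    pair-injective : ∀ F {k l} → pair F k ≡ pair F l → k ≡ l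
    pair-injective F {k} {l} eq = trans (sym (Fin.combine-remQuot {3} 2 k))
      (trans (cong₂ combine i≡i′ j≡j′) (Fin.combine-remQuot {3} 2 l))
      where
      i≡i′ : proj₁ (remQuot {3} 2 k) ≡ proj₁ (remQuot {3} 2 l)
      i≡i′ = corner-injective F (cong proj₁ eq)
      j≡j′ : proj₂ (remQuot {3} 2 k) ≡ proj₂ (remQuot {3} 2 l)
      j≡j′ = Fin.punchIn-injective (proj₁ (remQuot {3} 2 k)) _ _
        (trans (corner-injective F (cong proj₂ eq))
          (cong (λ i → punchIn i (proj₂ (remQuot {3} 2 l))) (sym i≡i′)))

    pair-surjective : ∀ {F a b} → Flag F a b → ∃ λ k → pair F k ≡ (a , b)
    pair-surjective {F} (flag a◁F b◁F a≢b) =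
      let i , i≡ = corner-surjective a◁F
          j , j≡ = corner-surjective b◁F
          i≢j    = λ i≡j → a≢b (trans (sym i≡) (trans (cong (corner F) i≡j) j≡))
          rq     = Fin.remQuot-combine i (punchOut i≢j)
      in combine i (punchOut i≢j)
       , cong₂ _,_
           (trans (cong (corner F ∘ proj₁) rq) i≡)
           (trans (cong (λ q → corner F (punchIn (proj₁ q) (proj₂ q))) rq)
             (trans (cong (corner F) (Fin.punchIn-punchOut i≢j)) j≡))

  FlagTransitive : Set
  FlagTransitive = ∀ {F F′ a b a′ b′} → Flag F a b → Flag F′ a′ b′ →
                   ∃ λ φ → φ ·ᶠ F ≡ F′ × φ ·ᵛ a ≡ a′ × φ ·ᵛ b ≡ b′

  module _ (base : Face) where

    private
      a₀ b₀ : Vertex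
      a₀ = proj₁ (pair base 0F)
      b₀ = proj₂ (pair base 0F)

    -- The number, among the flags of the image face, of the image of the base flag `pair base 0F`.
    -- Together with the image face it determines the automorphism, by rigidity.
    code : Automorphism → Fin 6
    code φ = proj₁ (pair-surjective (·-Flag φ (pair-flag base 0F)))

    private
      code-pair : ∀ φ → pair (φ ·ᶠ base) (code φ) ≡ (φ ·ᵛ a₀ , φ ·ᵛ b₀)
      code-pair φ = proj₂ (pair-surjective (·-Flag φ (pair-flag base 0F)))

    code-cong : ∀ φ ψ → φ ≈ᵃ ψ → code φ ≡ code ψ
    code-cong φ ψ φ≈ψ = pair-injective (ψ ·ᶠ base)
      (trans (subst (λ F → pair F (code φ) ≡ (φ ·ᵛ a₀ , φ ·ᵛ b₀)) (·ᶠ-cong φ ψ φ≈ψ base) (code-pair φ))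
        (trans (cong₂ _,_ (φ≈ψ a₀) (φ≈ψ b₀)) (sym (code-pair ψ))))

    code-rigid : ∀ φ ψ → φ ·ᶠ base ≡ ψ ·ᶠ base → code φ ≡ code ψ → φ ≈ᵃ ψ
    code-rigid φ ψ φF≡ eq =
      rigid φ ψ (pair-flag base 0F) φF≡ (cong proj₁ same) (cong proj₂ same)
      where
      same : (φ ·ᵛ a₀ , φ ·ᵛ b₀) ≡ (ψ ·ᵛ a₀ , ψ ·ᵛ b₀)
      same = trans (sym (code-pair φ)) (trans (cong₂ pair φF≡ eq) (code-pair ψ))

    code-surjective : FlagTransitive → ∀ F k → ∃ λ φ → φ ·ᶠ base ≡ F × code φ ≡ k
    code-surjective transitive F k =
      let φ , φbase≡ , φa≡ , φb≡ = transitive (pair-flag base 0F) (pair-flag F k)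
      in φ , φbase≡ , pair-injective F
           (trans (subst (λ L → pair L (code φ) ≡ (φ ·ᵛ a₀ , φ ·ᵛ b₀)) φbase≡ (code-pair φ))
             (cong₂ _,_ φa≡ φb≡))

  StabiliserOrder : ℕ → Set
  StabiliserOrder s = ∀ F → HasCard _≈ᵃ_ (λ φ → φ ·ᶠ F ≡ F) s

  -- By rigidity, the six elements of the stabiliser have distinct effects on a flag of the face,
  -- and there are only six flags.
  stabiliser-transitive : StabiliserOrder 6 → ∀ {F a b a′ b′} → Flag F a b → Flag F a′ b′ →
                          ∃ λ φ → φ ·ᶠ F ≡ F × φ ·ᵛ a ≡ a′ × φ ·ᵛ b ≡ b′
  stabiliser-transitive order {F} {a} {b} {a′} {b′} fl fl′ =
    let k′ , pair≡ = pair-surjective fl′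
        k , hit    = injective⇒surjective (↔-id (Fin 6)) effect effect-injective k′
        same       = trans (sym (effect-pair k)) (trans (cong (pair F) hit) pair≡)
    in φ k , fixes k , cong proj₁ same , cong proj₂ same
    where
    enum = proj₁ (order F)
    φ : Fin 6 → Automorphism
    φ k = proj₁ (enum k)
    fixes : ∀ k → φ k ·ᶠ F ≡ F
    fixes k = proj₂ (enum k)
    moved : ∀ k → ∃ λ l → pair F l ≡ (φ k ·ᵛ a , φ k ·ᵛ b)
    moved k = pair-surjective (subst (λ L → Flag L (φ k ·ᵛ a) (φ k ·ᵛ b)) (fixes k) (·-Flag (φ k) fl))
    effect : Fin 6 → Fin 6
    effect = proj₁ ∘ moved
    effect-pair : ∀ k → pair F (effect k) ≡ (φ k ·ᵛ a , φ k ·ᵛ b)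
    effect-pair = proj₂ ∘ moved
    effect-injective : ∀ {k l} → effect k ≡ effect l → k ≡ l
    effect-injective {k} {l} eq = proj₁ (proj₂ (order F))
      (rigid (φ k) (φ l) fl (trans (fixes k) (sym (fixes l))) (cong proj₁ same) (cong proj₂ same))
      where
      same : (φ k ·ᵛ a , φ k ·ᵛ b) ≡ (φ l ·ᵛ a , φ l ·ᵛ b)
      same = trans (sym (effect-pair k)) (trans (cong (pair F) eq) (effect-pair l))

  -- First move the face `F` to `F′`, then correct the two vertices by an element of the stabiliser
  -- of `F′`.
  flag-transitive : FaceTransitive → StabiliserOrder 6 → FlagTransitive
  flag-transitive transitive order {F} {F′} {a} {b} {a′} {b′} fl fl′ = move (transitive F F′)
    where
    Moving : Automorphism → Face → Vertex → Vertex → Set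
    Moving φ L c d = φ ·ᶠ L ≡ F′ × φ ·ᵛ c ≡ a′ × φ ·ᵛ d ≡ b′
    compose : ∀ ψ ρ → ψ ·ᶠ F ≡ F′ → Moving ρ F′ (ψ ·ᵛ a) (ψ ·ᵛ b) → Moving (ρ ∙ ψ) F a b
    compose ψ ρ ψF≡ (ρF′≡ , ρa≡ , ρb≡) =
      trans (∙-·ᶠ ρ ψ F) (trans (cong (ρ ·ᶠ_) ψF≡) ρF′≡) , ρa≡ , ρb≡
    move : (∃ λ ψ → ψ ·ᶠ F ≡ F′) → ∃ λ φ → Moving φ F a b
    move (ψ , ψF≡) =
      let ρ , moving = stabiliser-transitive order
            (subst (λ L → Flag L (ψ ·ᵛ a) (ψ ·ᵛ b)) ψF≡ (·-Flag ψ fl)) fl′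
      in ρ ∙ ψ , compose ψ ρ ψF≡ moving

  -- Counting automorphisms by the image of a base flag.

  HCard : ℕ → Set
  HCard = HasCard (Group._≈_ AutF) (Subgroup.member H)

  module _ {n : ℕ} (finite : Fin n ↔ Face) (base : Face) where

    private
      -- The image of the base flag, numbered among all flags of the surface.
      index : Automorphism → Fin (6 * n)
      index φ = combine (code base φ) (Inverse.from finite (φ ·ᶠ base))

      index-cong : ∀ φ ψ → φ ≈ᵃ ψ → index φ ≡ index ψ
      index-cong φ ψ φ≈ψ = cong₂ combine (code-cong base φ ψ φ≈ψ)
        (cong (Inverse.from finite) (·ᶠ-cong φ ψ φ≈ψ base))

      from-injective : ∀ {F G} → Inverse.from finite F ≡ Inverse.from finite G → F ≡ G
      from-injective {F} {G} eq = trans (sym (Inverse.strictlyInverseˡ finite F))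
        (trans (cong (Inverse.to finite) eq) (Inverse.strictlyInverseˡ finite G))

      index-injective : ∀ φ ψ → index φ ≡ index ψ → φ ≈ᵃ ψ
      index-injective φ ψ eq =
        let code≡ , face≡ = Fin.combine-injective (code base φ) _ (code base ψ) _ eq
        in code-rigid base φ ψ (from-injective face≡) code≡

    -- `index` is injective by rigidity and onto by flag-transitivity, so it numbers the
    -- automorphisms by `Fin (6 * n)`.
    FlagTransitive⇒HCard : FlagTransitive → HCard (6 * n)
    FlagTransitive⇒HCard transitive =
        (λ i → λX (φ i) , φ i , λ _ → refl)
      , (λ {i} {j} eq → trans (sym (index-φ i))
          (trans (index-cong (φ i) (φ j) (λX-injective (φ i) (φ j) eq)) (index-φ j)))
      , λ { (y , ψ , λψ≈y) → index ψ , λ { refl F →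
          trans (·ᶠ-cong (φ (index ψ)) ψ (index-injective (φ (index ψ)) ψ (index-φ (index ψ))) F) (λψ≈y F) } }
      where
      realised : (i : Fin (6 * n)) → ∃ λ φ → φ ·ᶠ base ≡ Inverse.to finite (proj₂ (remQuot {6} n i)) ×
                                       code base φ ≡ proj₁ (remQuot {6} n i)
      realised i = code-surjective base transitive _ _
      φ : Fin (6 * n) → Automorphism
      φ i = proj₁ (realised i)
      index-φ : ∀ i → index (φ i) ≡ i
      index-φ i = trans (cong₂ combine (proj₂ (proj₂ (realised i)))
          (trans (cong (Inverse.from finite) (proj₁ (proj₂ (realised i)))) (Inverse.strictlyInverseʳ finite _)))
        (Fin.combine-remQuot {6} n i)

    -- With `6 * n` automorphisms the injective `index` is onto, so each of the six flags of `base`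
    -- is the image of the base flag under some automorphism. These fix `base`, and by rigidity
    -- there are no others.
    HCard⇒stabiliser : HCard (6 * n) → HasCard _≈ᵃ_ (λ φ → φ ·ᶠ base ≡ base) 6
    HCard⇒stabiliser (enum , enum-injective , _) =
        (λ k → φ (hit k) , proj₂ (spec k))
      , (λ {k} {l} eq → trans (sym (proj₁ (spec k)))
          (trans (code-cong base (φ (hit k)) (φ (hit l)) eq) (proj₁ (spec l))))
      , λ { (ψ , ψbase≡) → code base ψ , λ { refl →
          code-rigid base (φ (hit (code base ψ))) ψ
            (trans (proj₂ (spec (code base ψ))) (sym ψbase≡)) (proj₁ (spec (code base ψ))) } }
      where
      φ : Fin (6 * n) → Automorphism
      φ i = proj₁ (proj₂ (enum i))
      index∘φ-injective : ∀ {i j} → index (φ i) ≡ index (φ j) → i ≡ j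
      index∘φ-injective {i} {j} eq = enum-injective λ F →
        trans (sym (proj₂ (proj₂ (enum i)) F))
          (trans (·ᶠ-cong (φ i) (φ j) (index-injective (φ i) (φ j) eq) F) (proj₂ (proj₂ (enum j)) F))
      preimage : ∀ k → ∃ λ i → index (φ i) ≡ combine k (Inverse.from finite base)
      preimage k = injective⇒surjective (↔-id (Fin (6 * n))) (index ∘ φ) index∘φ-injective _
      hit : Fin 6 → Fin (6 * n)
      hit k = proj₁ (preimage k)
      spec : ∀ k → code base (φ (hit k)) ≡ k × φ (hit k) ·ᶠ base ≡ base
      spec k = let code≡ , face≡ = Fin.combine-injective _ _ k _ (proj₂ (preimage k))
               in code≡ , from-injective face≡

-- Cycles defined by an automorphism and a single arc.

module _ (G : CubicGraph) where
  open CubicGraph G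
  open Covers G

  -- Each block consists of one node. When these nodes are distinct, removing duplicates changes
  -- nothing, so the size test in `α` succeeds.
  α-pair : ∀ σ ℓ F₁ F₂ → Unique (applyUpTo (λ i → power Aut σ i · F₁) ℓ) →
           α σ ℓ (F₁ ∷ F₂ ∷ []) ≡ applyUpTo (λ i → power Aut σ (suc i) · F₁) ℓ
  α-pair σ ℓ F₁ F₂ u = trans
    (cong (λ b → if b then concatMap (block σ ℓ F ∘ suc) (upTo ℓ) else [])
      (dec-true (∣Σ∣ σ ℓ F ℕ.≟ 1 * ℓ) size≡))
    (concatMap-[]-applyUpTo (λ i → power Aut σ (suc i) · F₁) (λ i → i) ℓ)
    where
    F = F₁ ∷ F₂ ∷ []
    nodes≡ : concatMap (block σ ℓ F) (upTo ℓ) ≡ applyUpTo (λ i → power Aut σ i · F₁) ℓ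
    nodes≡ = concatMap-[]-applyUpTo (λ i → power Aut σ i · F₁) (λ i → i) ℓ
    size≡ : ∣Σ∣ σ ℓ F ≡ 1 * ℓ
    size≡ = trans (cong (length ∘ deduplicate _≟_) nodes≡)
      (trans (cong length (unique⇒deduplicate≡ _≟_ u))
        (trans (length-applyUpTo _ ℓ) (sym (ℕ.*-identityˡ ℓ))))

-- Umbrellas form a vertex-faithful cycle double cover.

module VertexDefiningCycles {p} (X : SimplicialSurface p) where
  open SimplicialSurface X
  open SurfaceProperties X
  open Surfaces X
  open Geometry X
  open Umbrellas X
  open Automorphisms X
  open IsUmbrella
  open Next
  open Covers faceGraph using (Orbit; OnCycle; IsCycleDoubleCover; IsVertexFaithful; α)

  private
    u : ∀ v → IsUmbrella v (Umbrella.faces (umbrella v))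
    u v = umbrella-isUmbrella (umbrella v)

  VertexDefining⁻ : ∀ {C} → VertexDefining C → ∃ λ v → IsUmbrella v C
  VertexDefining⁻ (v , C≈) = v , IsUmbrella-resp-≈ᶜ C≈ (u v)

  VertexDefining⁺ : ∀ {v C} → IsUmbrella v C → VertexDefining C
  VertexDefining⁺ {v} uC = v , IsUmbrella-unique (u v) uC

  module _ {𝒞 : CycleSet} (𝒞≐ : 𝒞 ≐ VertexDefining) where

    private
      𝒞⁻ : ∀ {C} → 𝒞 C → ∃ λ v → IsUmbrella v C
      𝒞⁻ C∈ = VertexDefining⁻ (proj₁ 𝒞≐ C∈)

      𝒞⁺ : ∀ {v C} → IsUmbrella v C → 𝒞 C
      𝒞⁺ uC = proj₂ 𝒞≐ (VertexDefining⁺ uC)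

    isCycleDoubleCover : IsCycleDoubleCover 𝒞
    isCycleDoubleCover = cycles , double
      where
      cycles : ∀ C → 𝒞 C → 3 ≤ length C × Unique C × Cyclic Adjacent C
      cycles C C∈ = let v , uC = 𝒞⁻ C∈ in
        IsUmbrella⇒length≥3 uC , unique uC
        , subst (Cyclic Adjacent) (map-id C) (Cyclic-map⁺ (λ F → F) adjacent C (cyclic uC))
      double : ∀ F G → Adjacent F G → HasCard _≈ᶜ_ (λ C → 𝒞 C × OnCycle F G C) 2
      double F G FG = enum , enum-injective , enum-surjective
        where
        shared : Common F G
        shared = Adjacent⁻ FG
        a b : Vertex
        a = proj₁ shared
        b = proj₁ (proj₂ shared)
        a≢b : a ≢ b
        a≢b = proj₁ (proj₂ (proj₂ shared))
        Fa : Next a F G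
        Fa = let _ , _ , _ , a◁F , _ , a◁G , _ = shared in next a◁F a◁G FG
        Fb : Next b F G
        Fb = let _ , _ , _ , _ , b◁F , _ , b◁G = shared in next b◁F b◁G FG
        through : ∀ {v} → Next v F G → ∃ λ C → 𝒞 C × OnCycle F G C
        through {v} N = Umbrella.faces (umbrella v) , 𝒞⁺ (u v) , Next⇒consecutive (u v) N
        enum : Fin 2 → ∃ λ C → 𝒞 C × OnCycle F G C
        enum 0F = through Fa
        enum 1F = through Fb
        separate : ∀ {v w} → v ≢ w → ¬ Umbrella.faces (umbrella v) ≈ᶜ Umbrella.faces (umbrella w)
        separate {v} {w} v≢w eq = v≢w (IsUmbrella-vertex (IsUmbrella-resp-≈ᶜ eq (u v)) (u w))
        enum-injective : ∀ {i j} → proj₁ (enum i) ≈ᶜ proj₁ (enum j) → i ≡ j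
        enum-injective {0F} {0F} _  = refl
        enum-injective {1F} {1F} _  = refl
        enum-injective {0F} {1F} eq = contradiction eq (separate a≢b)
        enum-injective {1F} {0F} eq = contradiction eq (separate (≢-sym a≢b))
        -- A cycle through the arc is the umbrella of a vertex `w` on both `F` and `G`, and these
        -- share only `a` and `b`.
        enum-surjective : ∀ C → ∃ λ i → ∀ {j} → j ≡ i → proj₁ (enum j) ≈ᶜ proj₁ C
        enum-surjective (C , C∈ , _ , C≈) =
          let w , uC = 𝒞⁻ C∈
              next w◁F w◁G _ = consecutive⇒Next uC C≈
          in [ (λ w≡a → 0F , λ { refl → IsUmbrella-unique (u a) (subst (λ x → IsUmbrella x C) w≡a uC) })
             , (λ w≡b → 1F , λ { refl → IsUmbrella-unique (u b) (subst (λ x → IsUmbrella x C) w≡b uC) })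
             ]′ (common-only (proj₁ FG) a≢b (source Fa) (source Fb) (target Fa) (target Fb) w◁F w◁G)

    -- Chordless because adjacent faces at a vertex are consecutive on its umbrella. An arc common
    -- to the umbrellas of two vertices consists of two faces containing both vertices, and only two
    -- faces can contain both.
    isVertexFaithful : IsVertexFaithful 𝒞
    isVertexFaithful = chordless , λ C D C∈ D∈ C≉D F G F′ G′ → one-arc C D C∈ D∈ C≉D
      where
      chordless : ∀ C → 𝒞 C → ∀ F G → F ∈ₗ C → G ∈ₗ C → Adjacent F G → OnCycle F G C
      chordless C C∈ F G F∈ G∈ FG = let v , uC = 𝒞⁻ C∈ in
        Next⇒consecutive uC (next (Equivalence.to (complete uC F) F∈) (Equivalence.to (complete uC G) G∈) FG)
      one-arc : ∀ C D → 𝒞 C → 𝒞 D → ¬ C ≈ᶜ D → ∀ {F G F′ G′} →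
                OnCycle F G C → OnCycle F G D → OnCycle F′ G′ C → OnCycle F′ G′ D →
                (F ≡ F′ × G ≡ G′) ⊎ (F ≡ G′ × G ≡ F′)
      one-arc C D C∈ D∈ C≉D {F} {G} {F′} {G′} (_ , c) (_ , d) (_ , c′) (_ , d′) =
        let v , uC = 𝒞⁻ C∈
            w , uD = 𝒞⁻ D∈
        in arcs (λ v≡w → C≉D (IsUmbrella-unique uC (subst (λ x → IsUmbrella x D) (sym v≡w) uD)))
             (consecutive⇒Next uC c) (consecutive⇒Next uD d)
             (consecutive⇒Next uC c′) (consecutive⇒Next uD d′) (F ≟ᶠ F′)
        where
        arcs : ∀ {v w} → v ≢ w → Next v F G → Next w F G → Next v F′ G′ → Next w F′ G′ →
               Dec (F ≡ F′) → (F ≡ F′ × G ≡ G′) ⊎ (F ≡ G′ × G ≡ F′)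
        arcs v≢w (next v◁F v◁G (F≢G , _)) (next w◁F w◁G _) (next v◁F′ v◁G′ (F′≢G′ , _)) (next w◁F′ w◁G′ _) =
          λ { (yes F≡F′) → inj₁ (F≡F′ , across-unique v≢w v◁F w◁F F≢G v◁G w◁G
                (λ F≡G′ → F′≢G′ (trans (sym F≡F′) F≡G′)) v◁G′ w◁G′)
            ; (no F≢F′) → inj₂
                ( across-unique v≢w v◁F′ w◁F′ (≢-sym F≢F′) v◁F w◁F F′≢G′ v◁G′ w◁G′
                , across-unique v≢w v◁F w◁F F≢G v◁G w◁G F≢F′ v◁F′ w◁F′) }

  -- Turning an umbrella by one step.

  module _ (transitive : FlagTransitive) where

    vertex-transitive : ∀ v w → ∃ λ φ → φ ·ᵛ v ≡ w
    vertex-transitive v w =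
      let F , v◁F       = face-at v
          G , w◁G       = face-at w
          a , a◁F , a≢v = another F v
          b , b◁G , b≢w = another G w
          φ , _ , φv≡ , _ = transitive (flag v◁F a◁F (≢-sym a≢v)) (flag w◁G b◁G (≢-sym b≢w))
      in φ , φv≡

    record Turn (v : Vertex) (A B : Face) (C : List Face) : Set where
      field
        φ      : Automorphism
        fixes  : φ ·ᵛ v ≡ v
        steps  : φ ·ᶠ A ≡ B
        shifts : map (φ ·ᶠ_) (A ∷ C) ≡ C ∷ʳ A

    -- Let `va` be the edge between `A` and `B`, and `vb` the one between `B` and `D`. The
    -- automorphism taking the flag `(A, v, a)` to `(B, v, b)` sends `B` to the face across `vb`
    -- from `B`, which is `D`.
    turn : ∀ {v A B D ws} → IsUmbrella v (A ∷ B ∷ D ∷ ws) → Turn v A B (B ∷ D ∷ ws)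
    turn {v} {A} {B} {D} {ws} uC =
      let AB = Linked.head (cyclic uC)
          BD = Linked.head (Linked.tail (cyclic uC))
          a , a≢v , a◁A , a◁B = mate {v = v} (adjacent AB)
          b , b≢v , b◁B , b◁D = mate {v = v} (adjacent BD)
          φ , φA≡B , φv≡v , φa≡b =
            transitive (flag (source AB) a◁A (≢-sym a≢v)) (flag (source BD) b◁B (≢-sym b≢v))
          φB≡D = across-unique (≢-sym b≢v) (source BD) b◁B
            (λ B≡φB → proj₁ (adjacent AB) (·ᶠ-injective φ (trans φA≡B B≡φB)))
            (subst (_◁ φ ·ᶠ B) φv≡v (·-◁ φ (source BD))) (subst (_◁ φ ·ᶠ B) φa≡b (·-◁ φ a◁B))
            (proj₁ (adjacent BD)) (target BD) b◁D
          -- The image of the umbrella and its rotation by one place are umbrellas of `v` that both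
          -- start with `B`, `D`, so they are equal as lists.
          turned = subst₂ (λ L M → IsUmbrella v (L ∷ M ∷ map (φ ·ᶠ_) (D ∷ ws))) φA≡B φB≡D
            (subst (λ x → IsUmbrella x (map (φ ·ᶠ_) (A ∷ B ∷ D ∷ ws))) φv≡v (·-IsUmbrella φ uC))
          rotated = IsUmbrella-resp-≈ᶜ (inj₁ ([ A ] , B ∷ D ∷ ws , refl , refl)) uC
      in record
        { φ = φ ; fixes = φv≡v ; steps = φA≡B
        ; shifts = cong₂ _∷_ φA≡B (cong₂ _∷_ φB≡D (same-start⇒≡ turned rotated)) }

    module Rotation {v A B C} (uC : IsUmbrella v (A ∷ B ∷ C)) (t : Turn v A B (B ∷ C)) where
      open Turn t

      σ : Group.Carrier AutF
      σ = λX φ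

      ℓ : ℕ
      ℓ = length (A ∷ B ∷ C)

      private
        g : ℕ → Face
        g i = Inverse.to (proj₁ (power AutF σ i)) A

        orbit : A ∷ B ∷ C ≡ applyUpTo g ℓ × A ≡ g ℓ
        orbit = shifted⇒orbit (φ ·ᶠ_) g (λ _ → refl) (B ∷ C) shifts

        orbit-unique : Unique (applyUpTo g ℓ)
        orbit-unique = subst Unique (proj₁ orbit) (unique uC)

        power-face : ∀ i F → power Aut φ i ·ᶠ F ≡ Inverse.to (proj₁ (power AutF σ i)) F
        power-face zero    F = refl
        power-face (suc i) F = cong (φ ·ᶠ_) (power-face i F)

        power-fixes : ∀ i → power Aut φ i ·ᵛ v ≡ v
        power-fixes zero    = refl
        power-fixes (suc i) = trans (cong (φ ·ᵛ_) (power-fixes i)) fixes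

        power-comm : ∀ i F → power Aut φ i ·ᶠ φ ·ᶠ F ≡ φ ·ᶠ power Aut φ i ·ᶠ F
        power-comm zero    F = refl
        power-comm (suc i) F = cong (φ ·ᶠ_) (power-comm i F)

        -- Such a `P` preserves the edge between `A` and `B` and fixes its end `v`, so it fixes the
        -- other end as well, and with it a flag of `A`.
        closes : ∀ (P : Automorphism) → P ·ᵛ v ≡ v → P ·ᶠ A ≡ A → P ·ᶠ B ≡ B → P ≈ᵃ idᵃ
        closes P Pv≡v PA≡A PB≡B = fix-mate (mate {v = v} AB)
          where
          vAB : Next v A B
          vAB = Linked.head (cyclic uC)
          AB : Adjacent A B
          AB = adjacent vAB
          fix-mate : (∃ λ a → a ≢ v × a ◁ A × a ◁ B) → P ≈ᵃ idᵃ
          fix-mate (a , a≢v , a◁A , a◁B) = rigid P idᵃ (flag (source vAB) a◁A (≢-sym a≢v)) PA≡A Pv≡v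
            ([ (λ Pa≡v → contradiction (·ᵛ-injective P (trans Pa≡v (sym Pv≡v))) a≢v) , (λ Pa≡a → Pa≡a) ]′
              (common-only (proj₁ AB) (≢-sym a≢v) (source vAB) a◁A (target vAB) a◁B
                (subst (P ·ᵛ a ◁_) PA≡A (·-◁ P a◁A)) (subst (P ·ᵛ a ◁_) PB≡B (·-◁ P a◁B))))

        power-closes : ∀ i → A ≡ g i → power Aut φ i ≈ᵃ idᵃ
        power-closes i A≡gi = closes P (power-fixes i) PA≡A PB≡B
          where
          P : Automorphism
          P = power Aut φ i
          PA≡A : P ·ᶠ A ≡ A
          PA≡A = trans (power-face i A) (sym A≡gi)
          -- `B` is the image of `A` under `φ`, which commutes with its powers.
          PB≡B : P ·ᶠ B ≡ B
          PB≡B = trans (cong (P ·ᶠ_) (sym steps))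
            (trans (power-comm i A) (trans (cong (φ ·ᶠ_) PA≡A) steps))

      -- After `ℓ` steps `A` returns to itself, which by `power-closes` makes the power trivial; no
      -- earlier power fixes `A`, since the faces of the umbrella are distinct.
      σ-order : HasOrder AutF σ ℓ
      σ-order = s≤s z≤n
        , trivial ℓ (proj₂ orbit)
        , minimal
        where
        trivial : ∀ i → A ≡ g i → Group._≈_ AutF (power AutF σ i) (Group.ε AutF)
        trivial i A≡gi F =
          trans (sym (power-face i F)) (·ᶠ-cong (power Aut φ i) idᵃ (power-closes i A≡gi) F)
        minimal : ∀ k → 0 < k → k < ℓ → ¬ Group._≈_ AutF (power AutF σ k) (Group.ε AutF)
        minimal (suc k) _ (s≤s k<) σᵏ≈1 =
          All.lookup (AllPairs.head orbit-unique) (∈-applyUpTo⁺ (g ∘ suc) k<) (sym (σᵏ≈1 A))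

      -- The cycle `α` starts at the first image of `A`, not at `A`, so as a list it is the
      -- `φ`-image of the given umbrella.
      α-isUmbrella : IsUmbrella v (α σ ℓ (A ∷ B ∷ []))
      α-isUmbrella = subst (IsUmbrella v) (sym α≡)
        (subst (λ x → IsUmbrella x (map (φ ·ᶠ_) (A ∷ B ∷ C))) fixes (·-IsUmbrella φ uC))
        where
        α≡ : α σ ℓ (A ∷ B ∷ []) ≡ map (φ ·ᶠ_) (A ∷ B ∷ C)
        α≡ = trans (α-pair faceGraph σ ℓ A B orbit-unique)
          (trans (sym (map-applyUpTo g (φ ·ᶠ_) ℓ)) (cong (map (φ ·ᶠ_)) (sym (proj₁ orbit))))

    Orbit≐VertexDefining : ∀ {v C} → IsUmbrella v C → Orbit H C ≐ VertexDefining
    Orbit≐VertexDefining {v} {C} uC = to , from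
      where
      to : ∀ {D} → Orbit H C D → VertexDefining D
      to {D} (h , (φ , λφ≈h) , hC≈D) = VertexDefining⁺ (IsUmbrella-resp-≈ᶜ
        (subst (_≈ᶜ D) (sym (map-cong λφ≈h C)) hC≈D) (·-IsUmbrella φ uC))
      from : ∀ {D} → VertexDefining D → Orbit H C D
      from D∈ =
        let w , uD   = VertexDefining⁻ D∈
            φ , φv≡w = vertex-transitive v w
        in λX φ , (φ , λ _ → refl)
         , IsUmbrella-unique (·-IsUmbrella φ uC) (subst (λ x → IsUmbrella x _) (sym φv≡w) uD)

  -- The two directions of the equivalence.

  OneSixCover : Set
  OneSixCover = ∃ λ (h : IsOneSixGroup H) → IsOneSixGroup.𝒞¹⁶ h ≐ VertexDefining

  oneSixCover : FaceTransitive → HCard (6 * #cells 2) →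
                ∀ {A B} σ ℓ → Adjacent A B → Subgroup.member H σ → Inverse.to (proj₁ σ) A ≡ B →
                HasOrder AutF σ ℓ → Orbit H (α σ ℓ (A ∷ B ∷ [])) ≐ VertexDefining → OneSixCover
  oneSixCover face-transitive card {A} {B} σ ℓ AB σ∈H σA≡B order cover≐ = record
    { transitive         = λ F G → let φ , φF≡G = face-transitive F G in λX φ , (φ , λ _ → refl) , φF≡G
    ; cardinality        = card
    ; F₁                 = A
    ; F₂                 = B
    ; F₁~F₂              = AB
    ; σ                  = σ
    ; σ∈H                = σ∈H
    ; σF₁≡F₂             = σA≡B
    ; ℓ                  = ℓ
    ; σ-order            = order
    ; isCycleDoubleCover = isCycleDoubleCover cover≐
    ; isVertexFaithful   = isVertexFaithful cover≐
    } , cover≐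

  vf⇒OneSixGroup : FaceTransitive → StabiliserOrder 6 → OneSixCover
  vf⇒OneSixGroup face-transitive order =
    build (flag-transitive face-transitive order) (Umbrella.faces (umbrella v)) (u v)
    where
    v : Vertex
    v = corner some-face 0F
    along : (transitive : FlagTransitive) → ∀ {A B C} → IsUmbrella v (A ∷ B ∷ C) →
            Turn transitive v A B (B ∷ C) → OneSixCover
    along transitive uC t =
      oneSixCover face-transitive (FlagTransitive⇒HCard (cells-finite 2) some-face transitive)
        σ ℓ (adjacent (Linked.head (cyclic uC))) (Turn.φ t , λ _ → refl) (Turn.steps t) σ-order
        (Orbit≐VertexDefining transitive α-isUmbrella)
      where open Rotation transitive uC t
    build : FlagTransitive → ∀ C → IsUmbrella v C → OneSixCover
    -- An umbrella has at least three faces, so the three consecutive faces used by `turn` exist.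
    build _ []           uC = contradiction (IsUmbrella⇒length≥3 uC) λ ()
    build _ (_ ∷ [])     uC = contradiction (IsUmbrella⇒length≥3 uC) λ { (s≤s ()) }
    build _ (_ ∷ _ ∷ []) uC = contradiction (IsUmbrella⇒length≥3 uC) λ { (s≤s (s≤s ())) }
    build transitive (_ ∷ _ ∷ _ ∷ _) uC = along transitive uC (turn transitive uC)

  -- The umbrellas of `v` and `w` are the images of `C` under some `φ` and `φ′`. Hence `φ′ ∙ (φ ⁻¹)`
  -- carries the faces at `v` to faces at `w`, and a vertex is determined by its faces.
  Orbit⇒same-orbit : ∀ {C} → Orbit H C ≐ VertexDefining → ∀ v w → SameOrbit v w
  Orbit⇒same-orbit {C} 𝒞≐ v w = relate (proj₂ 𝒞≐ (VertexDefining⁺ (u v))) (proj₂ 𝒞≐ (VertexDefining⁺ (u w)))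
    where
    faces : Vertex → List Face
    faces x = Umbrella.faces (umbrella x)
    relate : Orbit H C (faces v) → Orbit H C (faces w) → SameOrbit v w
    relate (h , (φ , λφ≈h) , hC≈) (h′ , (φ′ , λφ′≈h′) , h′C≈) =
      ψ , vertex-≡-from-faces (λ L ψv◁L →
        subst (w ◁_) (·ᶠ-inverseʳ ψ L)
          (carry (ψ⁻¹ L) (·-◁⁻ ψ (subst (ψ ·ᵛ v ◁_) (sym (·ᶠ-inverseʳ ψ L)) ψv◁L))))
      where
      ψ : Automorphism
      ψ = φ′ ∙ (φ ⁻¹)
      ψ⁻¹ : Face → Face
      ψ⁻¹ L = (ψ ⁻¹) ·ᶠ L
      -- Such an `M` is `φ ·ᶠ K` for some `K` on `C`, so `ψ ·ᶠ M` is `φ′ ·ᶠ K`, a face of the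
      -- umbrella of `w`.
      carry : ∀ M → v ◁ M → w ◁ ψ ·ᶠ M
      carry M v◁M =
        let M∈           = subst (M ∈ₗ_) (sym (map-cong λφ≈h C))
                             (∈-resp-↭ (↭-sym (≈ᶜ⇒↭ hC≈)) (Equivalence.from (complete (u v) M) v◁M))
            K , K∈ , M≡  = ∈-map⁻ (φ ·ᶠ_) M∈
            φ′K∈         = ∈-resp-↭ (≈ᶜ⇒↭ h′C≈)
                             (subst (φ′ ·ᶠ K ∈ₗ_) (map-cong λφ′≈h′ C) (∈-map⁺ (φ′ ·ᶠ_) K∈))
        in subst (w ◁_)
             (cong (φ′ ·ᶠ_) (trans (sym (·ᶠ-inverseˡ φ K)) (cong ((φ ⁻¹) ·ᶠ_) (sym M≡))))
             (Equivalence.to (complete (u w) (φ′ ·ᶠ K)) φ′K∈)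

  OneSixGroup⇒vf : (h : IsOneSixGroup H) → IsOneSixGroup.𝒞¹⁶ h ≐ VertexDefining →
                   FaceTransitive × HasVF (1 , 6)
  OneSixGroup⇒vf h 𝒞≐ =
      (λ F G → let σ , (φ , λφ≈σ) , σF≡G = transitive F G in φ , trans (λφ≈σ F) σF≡G)
    -- Any vertex can represent the single orbit; a corner of some face supplies one.
    , ( (λ _ → corner some-face 0F , _)
      , (λ { {0F} {0F} _ → refl })
      , λ { (w , _) → 0F , λ _ → Orbit⇒same-orbit 𝒞≐ (corner some-face 0F) w } )
    , λ F → HCard⇒stabiliser (cells-finite 2) F cardinality
    where open IsOneSixGroup h

theorem4p11 : ∀ {p : ℕ} (X : SimplicialSurface p) →
    let open Surfaces X in
    (FaceTransitive × HasVF (1 , 6)) ⇔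
    (∃ λ (h : IsOneSixGroup H) → IsOneSixGroup.𝒞¹⁶ h ≐ VertexDefining)
theorem4p11 X = mk⇔
  (λ { (transitive , _ , order) → vf⇒OneSixGroup transitive order })
  (λ { (h , 𝒞≐) → OneSixGroup⇒vf h 𝒞≐ })
  where open VertexDefiningCycles X
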